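{- For any integers $n,k$ with $2\le k\le\log_2\log_2 n$, there is a deterministic algorithm which, given a set $X$ of $n$ elements and $i\in\{1,\dots,n\}$, finds an element of $k$-order $i$ in $X$ using at most $25\cdot 2^{k-1}n^{1+2^{1-k}}+5\cdot 2^{2k-3}n^{2^{1-k}}c_n$ comparisons, where $c_n=\min\{\binom{n}{2},\binom{215}{2}\}$.
   Context: Model: each element $x_i$ has an unknown real value $\mathrm{val}(x_i)$. A comparator query on $x_i,x_j$ returns "$x_i\ge x_j$" or "$x_j\ge x_i$"; the answer is correct if $|\mathrm{val}(x_i)-\mathrm{val}(x_j)|>1$ and arbitrary (possibly adversarial) otherwise. For $k\ge0$, $x\le_k y$ means $\mathrm{val}(x)\le\mathrm{val}(y)+k$; for sets, $A\le_k B$ means $a\le_k b$ for all $a\in A,b\in B$. An element $x_j\in X$ is of $k$-order $i$ if there is a partition $S_1,S_2$ of $X\setminus\{x_j\}$ with $|S_1|=i-1$ and $S_1\cup\{x_j\}\le_k S_2\cup\{x_j\}$. The output must have this property for every input and every consistent comparator behavior.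
   Formalization: The unknown values val(x_i) of the elements are taken to be rational numbers instead of real numbers. -}

module Defs where

open import Data.Nat using (ℕ; zero; suc; _⊔_; _⊓_; _*_; _+_; _∸_; _^_)
open import Data.Nat.Combinatorics using (_C_)
open import Data.Integer using (+_)
open import Data.Rational using (ℚ; 1ℚ) renaming (_≤_ to _≤ℚ_; _+_ to _+ℚ_; _/_ to _/ℚ_)
open import Data.Fin using (Fin)
open import Data.Fin.Subset using (Subset; _∈_; _∉_; ∣_∣)
open import Data.Product using (Σ; _×_)
open import Data.Sum using (_⊎_)
open import Relation.Binary.PropositionalEquality using (_≡_)

Values : ℕ → Set
Values n = Fin n → ℚ

⟦_⟧ : ℕ → ℚ
⟦ m ⟧ = + m /ℚ 1

_≤[_]_ : ℚ → ℕ → ℚ → Set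
a ≤[ k ] b = a ≤ℚ (b +ℚ ⟦ k ⟧)

-- x_j is of k-order i (i is 1-based): there is a partition S₁ , S₂ of X∖{x_j}
-- with |S₁| = i - 1 and S₁ ∪ {x_j} ≤_k S₂ ∪ {x_j}.
-- S₁ is a subset not containing j, S₂ is its complement minus j, so
-- S₂ ∪ {x_j} is exactly the set of elements outside S₁.
IsKOrder : {n : ℕ} → Values n → (k i : ℕ) → Fin n → Set
IsKOrder {n} val k i j =
  Σ (Subset n) λ S₁ →
    (j ∉ S₁) × (∣ S₁ ∣ ≡ i ∸ 1) ×
    (∀ (a b : Fin n) → (a ∈ S₁ ⊎ a ≡ j) → b ∉ S₁ → val a ≤[ k ] val b)

-- Deterministic comparison algorithms on n elements = decision trees.
-- node a b l r : query the comparator on (x_a , x_b); continue with l if the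
-- answer is "x_a ≥ x_b", with r if the answer is "x_b ≥ x_a".
data Tree (n : ℕ) : Set where
  leaf : Fin n → Tree n
  node : Fin n → Fin n → Tree n → Tree n → Tree n

depth : {n : ℕ} → Tree n → ℕ
depth (leaf _) = 0
depth (node _ _ l r) = suc (depth l ⊔ depth r)

-- The answer "x_a ≥ x_b" is admissible unless it is wrong while
-- |val a - val b| > 1, i.e. unless val b > val a + 1.
Admissible : {n : ℕ} → Values n → Fin n → Fin n → Set
Admissible val a b = val b ≤ℚ (val a +ℚ 1ℚ)

-- Every run of the tree, under every comparator behaviour consistent with the
-- model (answers may be arbitrary, even inconsistent across repeated queries,
-- when values differ by at most 1), ends in a leaf satisfying P.
AlwaysOutputs : {n : ℕ} → Values n → (Fin n → Set) → Tree n → Set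
AlwaysOutputs val P (leaf x) = P x
AlwaysOutputs val P (node a b l r) =
  (Admissible val a b → AlwaysOutputs val P l) ×
  (Admissible val b a → AlwaysOutputs val P r)

cN : ℕ → ℕ
cN n = (n C 2) ⊓ (215 C 2)

-- The bound 25·2^{k-1}·n^{1+2^{1-k}} + 5·2^{2k-3}·n^{2^{1-k}}·c_n equals
-- A · n^{1/m} with m = 2^{k-1} and A = 25·2^{k-1}·n + 5·2^{2k-3}·c_n.
-- Hence  d ≤ bound  ⟺  d^m ≤ A^m · n  (all quantities nonnegative).
boundFactor : ℕ → ℕ → ℕ
boundFactor n k = 25 * 2 ^ (k ∸ 1) * n + 5 * 2 ^ (2 * k ∸ 3) * cN n

WithinBound : ℕ → ℕ → ℕ → Set
WithinBound n k d = d ^ (2 ^ (k ∸ 1)) Data.Nat.≤ boundFactor n k ^ (2 ^ (k ∸ 1)) * n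

module Submission where

-- Quickselect keeps a current set Y together with the elements already discarded below and above
-- it.  Cutting Y at an element z costs error 2 at most, but the adversary can answer so that the
-- cut removes almost nothing.  If z is the centre of a pivot, that is, if equally large sets are
-- known to lie below and above z up to error k - 1, then one of them can be discarded along with
-- z whichever way the cut falls, and the total error is still at most k.
--
-- Pivots are grown from single elements in k - 1 levels.  In a tournament on 4h + 1 centres some
-- centre has h others on either side; it absorbs their sets, which multiplies the size by h + 1
-- and adds 1 to the error.  Let m = 2^(k-1) and r = ⌊n^(1/m)⌋.  Starting with h = r + 1 and
-- squaring h from level to level keeps the cost geometric, at most 8 (r + 1) N for |Y| = N, and
-- leaves at most 6 r pivots, which are then compared with all of Y.  As 2h + 1 pivots are consumed
-- for every factor h + 1, the final pivots jointly discard at least 2N/(3m) elements.  So a phase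
-- costs at most 24 m r comparisons per discarded element.

open import Defs
import Algebra.Solver.CommutativeMonoid as CommutativeMonoidSolver
open import Data.Bool.Base using (Bool; true; false; not; if_then_else_)
import Data.Bool.Properties as Bool
open import Data.Empty using (⊥-elim)
open import Data.Fin using (Fin; zero; suc)
import Data.Fin.Properties as Fin
open import Data.Fin.Subset using (Subset; inside; ∣_∣) renaming (_∈_ to _∈ˢ_; _∉_ to _∉ˢ_; ⊥ to ∅)
open import Data.Fin.Subset.Properties using (∉⊥; ∣⊥∣≡0)
import Data.Integer as ℤ
import Data.Integer.Properties as ℤ
open import Data.List.Base
  using (List; []; _∷_; [_]; _++_; length; filter; map; concatMap; take; drop; allFin)
import Data.List.Properties as List
open import Data.List.Properties using (length-++; filter-reject; take++drop≡id; length-take)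
open import Data.List.Membership.Propositional using (_∈_; _∉_; find; lose)
open import Data.List.Membership.Propositional.Properties
  using (∈-filter⁻; ∈-++⁺ˡ; ∈-++⁺ʳ; ∈-++⁻; ∈-∃++; ∈-allFin; ∈-concatMap⁻; ∈-map⁺)
open import Data.List.Relation.Binary.Permutation.Propositional renaming (trans to compose)
open import Data.List.Relation.Binary.Permutation.Propositional.Properties
import Data.List.Relation.Binary.Permutation.Setoid.Properties as Permutationₛ
import Data.List.Relation.Binary.Sublist.Propositional.Properties as Sub
open import Data.List.Relation.Unary.All as All using (All; []; _∷_)
import Data.List.Relation.Unary.All.Properties as All
open import Data.List.Relation.Unary.AllPairs as AllPairs using (AllPairs; []; _∷_)
import Data.List.Relation.Unary.AllPairs.Properties as AllPairs
open import Data.List.Relation.Unary.Any using (here; there; any?)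
open import Data.List.Relation.Unary.Unique.Propositional using (Unique)
open import Data.List.Relation.Unary.Unique.Propositional.Properties using (allFin⁺)
open import Data.Nat
open import Data.Nat.ListAction using (sum)
open import Data.Nat.Properties
open import Data.Nat.Solver using (module +-*-Solver)
open import Data.Product using (Σ; ∃; _×_; _,_; proj₁; proj₂)
open import Data.Rational using (0ℚ; toℚᵘ) renaming (_≤_ to _≤ℚ_; _+_ to _+ℚ_)
import Data.Rational.Properties as ℚ
import Data.Rational.Unnormalised as ℚᵘ
import Data.Rational.Unnormalised.Properties as ℚᵘ
open import Data.Sum using (_⊎_; inj₁; inj₂; [_,_]′)
open import Data.Unit.Base using (⊤)
open import Data.Vec.Base using ([]; _∷_; _[_]≔_; here; there)
open import Data.Vec.Properties
  using ([]≔-updates; []≔-minimal; []=⇒lookup; lookup⇒[]=; lookup∘update′)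
open import Function.Base using (id; _∘_; case_of_)
open import Relation.Binary.PropositionalEquality
  using (_≡_; _≢_; refl; sym; trans; cong; cong₂; subst; setoid)
open import Relation.Nullary using (¬_; Dec; yes; no; does; contradiction)
open import Relation.Nullary.Decidable using (decidable-stable; ¬?; _×-dec_)
open import Relation.Unary using (Decidable)
open import Relation.Unary.Properties using (∁?)
open +-*-Solver using (solve; _:+_; _:*_; con; _:=_)

private variable
  A : Set

-- Filters, duplicate-free lists and permutations.

filter-∁-↭ : {P : A → Set} (P? : Decidable P) (xs : List A) →
             filter P? xs ++ filter (∁? P?) xs ↭ xs
filter-∁-↭ P? [] = ↭-refl
filter-∁-↭ P? (x ∷ xs) with P? x
... | yes _ = prep x (filter-∁-↭ P? xs)
... | no  _ = ↭-trans (shift x (filter P? xs) _) (prep x (filter-∁-↭ P? xs))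

length-filter-mono : {P Q : A → Set} (P? : Decidable P) (Q? : Decidable Q) (xs : List A) →
  (∀ {x} → x ∈ xs → P x → Q x) → length (filter P? xs) ≤ length (filter Q? xs)
length-filter-mono P? Q? [] f = z≤n
length-filter-mono P? Q? (x ∷ xs) f with P? x | Q? x
... | yes _ | yes _ = s≤s (length-filter-mono P? Q? xs (f ∘ there))
... | yes p | no ¬q = contradiction (f (here refl) p) ¬q
... | no  _ | yes _ = m≤n⇒m≤1+n (length-filter-mono P? Q? xs (f ∘ there))
... | no  _ | no  _ = length-filter-mono P? Q? xs (f ∘ there)

length-filter-cover : {P Q : A → Set} (P? : Decidable P) (Q? : Decidable Q) (xs : List A) →
  (∀ {x} → x ∈ xs → P x ⊎ Q x) → length xs ≤ length (filter P? xs) + length (filter Q? xs)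
length-filter-cover P? Q? xs cover = begin
  length xs                                                ≡⟨ ↭-length (filter-∁-↭ P? xs) ⟨
  length (filter P? xs ++ filter (∁? P?) xs)               ≡⟨ length-++ (filter P? xs) ⟩
  length (filter P? xs) + length (filter (∁? P?) xs)
    ≤⟨ +-monoʳ-≤ _ (length-filter-mono (∁? P?) Q? xs other) ⟩
  length (filter P? xs) + length (filter Q? xs)            ∎
  where
  open ≤-Reasoning
  other : ∀ {x} → x ∈ xs → ¬ _ → _
  other x∈ ¬p with cover x∈
  ... | inj₁ p = contradiction p ¬p
  ... | inj₂ q = q

Unique⇒∉ : {x : A} {xs : List A} → All (x ≢_) xs → x ∉ xs
Unique⇒∉ ps x∈ = All.lookup ps x∈ refl

Unique-++ : {xs ys : List A} → Unique xs → Unique ys → (∀ {x} → x ∈ xs → x ∉ ys) → Unique (xs ++ ys)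
Unique-++ ux uy dis = AllPairs.++⁺ ux uy (All.tabulate λ x∈ →
  All.tabulate λ { y∈ refl → dis x∈ y∈ })

Unique-++⁻ : (xs : List A) {ys : List A} → Unique (xs ++ ys) →
             Unique xs × Unique ys × (∀ {x} → x ∈ xs → x ∉ ys)
Unique-++⁻ [] u = [] , u , λ ()
Unique-++⁻ (x ∷ xs) (px ∷ u) with Unique-++⁻ xs u
... | ux , uy , dis = All.tabulate (λ y∈ → All.lookup px (∈-++⁺ˡ y∈)) ∷ ux , uy ,
  λ { (here refl) y∈ → Unique⇒∉ px (∈-++⁺ʳ xs y∈) ; (there x∈) → dis x∈ }

Unique-resp : {xs ys : List A} → xs ↭ ys → Unique xs → Unique ys
Unique-resp p = Permutationₛ.Unique-resp-↭ (setoid _) (↭⇒↭ₛ p)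

Unique-length-≤ : {xs ys : List A} → Unique xs → (∀ {x} → x ∈ xs → x ∈ ys) → length xs ≤ length ys
Unique-length-≤ {xs = []} u f = z≤n
Unique-length-≤ {xs = x ∷ xs} (px ∷ u) f with ∈-∃++ (f (here refl))
... | as , bs , refl = ≤-trans (s≤s (Unique-length-≤ u f′))
    (≤-reflexive (sym (↭-length (shift x as bs))))
  where
  f′ : ∀ {y} → y ∈ xs → y ∈ as ++ bs
  f′ y∈ with ∈-resp-↭ (shift x as bs) (f (there y∈))
  ... | here refl = contradiction y∈ (Unique⇒∉ px)
  ... | there q = q

concatMap-↭ : {B : Set} (f : A → List B) {xs ys : List A} → xs ↭ ys →
    concatMap f xs ↭ concatMap f ys
concatMap-↭ f refl = refl
concatMap-↭ f (prep x p) = ++⁺ˡ (f x) (concatMap-↭ f p)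
concatMap-↭ f (swap {xs} {ys} x y p) = ↭-trans (++⁺ˡ (f x) (++⁺ˡ (f y) (concatMap-↭ f p)))
  (shifts (f x) (f y))
concatMap-↭ f (compose p q) = ↭-trans (concatMap-↭ f p) (concatMap-↭ f q)

sum-map-≤ : (f : A → ℕ) (c : ℕ) (xs : List A) → (∀ {x} → x ∈ xs → f x ≤ c) →
  sum (map f xs) ≤ length xs * c
sum-map-≤ f c [] h = z≤n
sum-map-≤ f c (x ∷ xs) h = +-mono-≤ (h (here refl)) (sum-map-≤ f c xs (h ∘ there))

-- Degree counting in tournaments and approximate medians.

triangle : ℕ → ℕ
triangle zero = 0
triangle (suc m) = m + triangle m

2*triangle : ∀ m → 2 * triangle (suc m) ≡ m * suc m
2*triangle zero = refl
2*triangle (suc m) = trans (*-distribˡ-+ 2 (suc m) (triangle (suc m)))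
  (trans (cong (_+_ (2 * suc m)) (2*triangle m))
  (solve 1 (λ m → con 2 :* (con 1 :+ m) :+ m :* (con 1 :+ m) := (con 1 :+ m) :* (con 2 :+ m))
      refl m))

module _ {U : A → A → Set} (U? : ∀ x → Decidable (U x)) where

  degree : List A → A → ℕ
  degree xs x = length (filter (U? x) xs)

  private
    -- Counting against `x ∷ zs` instead of `zs` raises the degree of each `y` with `U y x` by one.
    -- The summation list `xs` is kept apart from `zs` so that the induction can vary it alone.
    degree-∷ : ∀ x xs zs →
      degree zs x + length (filter (λ y → U? y x) xs) + sum (map (degree zs) xs)
        ≤ degree (x ∷ zs) x + sum (map (degree (x ∷ zs)) xs)
    degree-∷ x [] zs = ≤-trans (≤-reflexive (cong (_+ 0) (+-identityʳ _))) (+-monoˡ-≤ 0 self)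
      where
      self : degree zs x ≤ degree (x ∷ zs) x
      self with U? x x
      ... | yes _ = n≤1+n _
      ... | no _ = ≤-refl
    degree-∷ x (y ∷ xs) zs with U? y x | degree-∷ x xs zs
    ... | yes _ | ih = begin
      D + suc c + (e + s)
        ≡⟨ solve 4 (λ D c e s → D :+ (con 1 :+ c) :+ (e :+ s) := con 1 :+ e :+ (D :+ c :+ s))
            refl D c e s ⟩
      suc e + (D + c + s)   ≤⟨ +-monoʳ-≤ (suc e) ih ⟩
      suc e + (D′ + s′)
        ≡⟨ solve 3 (λ e D s → con 1 :+ e :+ (D :+ s) := D :+ (con 1 :+ e :+ s)) refl e D′ s′ ⟩
      D′ + (suc e + s′)     ∎
      where
      open ≤-Reasoning
      D = degree zs x
      c = length (filter (λ y → U? y x) xs)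
      e = degree zs y
      s = sum (map (degree zs) xs)
      D′ = degree (x ∷ zs) x
      s′ = sum (map (degree (x ∷ zs)) xs)
    ... | no _ | ih = begin
      D + c + (e + s)
        ≡⟨ solve 4 (λ D c e s → D :+ c :+ (e :+ s) := e :+ (D :+ c :+ s)) refl D c e s ⟩
      e + (D + c + s)   ≤⟨ +-monoʳ-≤ e ih ⟩
      e + (D′ + s′)     ≡⟨ solve 3 (λ e D s → e :+ (D :+ s) := D :+ (e :+ s)) refl e D′ s′ ⟩
      D′ + (e + s′)     ∎
      where
      open ≤-Reasoning
      D = degree zs x
      c = length (filter (λ y → U? y x) xs)
      e = degree zs y
      s = sum (map (degree zs) xs)
      D′ = degree (x ∷ zs) x
      s′ = sum (map (degree (x ∷ zs)) xs)

  -- Double counting: every pair contributes to the degree of at least one of its two members.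
  triangle-≤-degrees : ∀ {xs} → AllPairs (λ x y → U x y ⊎ U y x) xs →
                       triangle (length xs) ≤ sum (map (degree xs) xs)
  triangle-≤-degrees [] = z≤n
  triangle-≤-degrees {x ∷ xs} (px ∷ ps) = ≤-trans
    (+-mono-≤ (length-filter-cover (U? x) (λ y → U? y x) xs (All.lookup px))
        (triangle-≤-degrees ps))
    (degree-∷ x xs xs)

  -- With `l` elements of degree at most `g - 1` there are at most `l (g - 1)` related pairs, but
  -- all `l (l - 1) / 2` pairs are related.
  low-degree-bound : ∀ {xs} g → AllPairs (λ x y → U x y ⊎ U y x) xs →
    (∀ {x} → x ∈ xs → degree xs x < g) → length xs ≤ 2 * g
  low-degree-bound {[]} g _ _ = z≤n
  low-degree-bound {xs@(_ ∷ ys)} zero ps low = contradiction (low (here refl)) λ ()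
  low-degree-bound {xs@(_ ∷ ys)} (suc g) ps low = ≤-trans
      (s≤s (*-cancelʳ-≤ (length ys) (2 * g) (length xs) bound))
    (≤-trans (n≤1+n _) (≤-reflexive (cong suc (sym (+-suc g (g + 0))))))
    where
    open ≤-Reasoning
    bound : length ys * length xs ≤ 2 * g * length xs
    bound = begin
      length ys * length xs            ≡⟨ 2*triangle (length ys) ⟨
      2 * triangle (length xs)         ≤⟨ *-monoʳ-≤ 2 (triangle-≤-degrees ps) ⟩
      2 * sum (map (degree xs) xs)     ≤⟨ *-monoʳ-≤ 2 (sum-map-≤ _ g xs (s≤s⁻¹ ∘ low)) ⟩
      2 * (length xs * g)
        ≡⟨ solve 2 (λ l g → con 2 :* (l :* g) := con 2 :* g :* l) refl (length xs) g ⟩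
      2 * g * length xs                ∎

  -- Restricting the list to its elements of low degree can only lower degrees further, so
  -- `low-degree-bound` applies to them.
  few-low-degrees : ∀ {xs} g → AllPairs (λ x y → U x y ⊎ U y x) xs →
    length (filter (λ x → degree xs x <? g) xs) ≤ 2 * g
  few-low-degrees {xs} g ps = low-degree-bound g (AllPairs.filter⁺ low? ps) λ x∈ →
    ≤-<-trans (Sub.length-mono-≤ (Sub.filter⁺ (U? _) (U? _) (λ { refl → id })
        (Sub.filter-⊆ low? xs)))
              (proj₂ (∈-filter⁻ low? {xs = xs} x∈))
    where low? = λ x → degree xs x <? g

-- At most `2 * g` elements have low degree for `U` and at most `2 * g` for `D`; more than `4 * g`
-- elements leave one that is low for neither.
median : {U D : A → A → Set} (U? : ∀ x → Decidable (U x)) (D? : ∀ x → Decidable (D x))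
    {xs : List A} (g : ℕ) →
  AllPairs (λ x y → U x y ⊎ U y x) xs → AllPairs (λ x y → D x y ⊎ D y x) xs → 4 * g < length xs →
  ∃ λ x → x ∈ xs × g ≤ degree U? xs x × g ≤ degree D? xs x
median U? D? {xs} g pu pd big with any? (λ x → (g ≤? degree U? xs x) ×-dec (g ≤? degree D? xs x)) xs
... | yes found = find found
... | no none = contradiction big (≤⇒≯ (begin
    length xs                           ≤⟨ length-filter-cover lowU? lowD? xs cover ⟩
    length (filter lowU? xs) + length (filter lowD? xs)
      ≤⟨ +-mono-≤ (few-low-degrees U? g pu) (few-low-degrees D? g pd) ⟩
    2 * g + 2 * g
      ≡⟨ solve 1 (λ g → con 2 :* g :+ con 2 :* g := con 4 :* g) refl g ⟩
    4 * g                               ∎))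
  where
  open ≤-Reasoning
  lowU? = λ x → degree U? xs x <? g
  lowD? = λ x → degree D? xs x <? g
  cover : ∀ {x} → x ∈ xs → degree U? xs x < g ⊎ degree D? xs x < g
  cover {x} x∈ with g ≤? degree U? xs x | g ≤? degree D? xs x
  ... | no p  | _ = inj₁ (≰⇒> p)
  ... | yes _ | no p = inj₂ (≰⇒> p)
  ... | yes p | yes q = ⊥-elim (none (lose x∈ (p , q)))

-- Rational inequalities with an additive error.

⟦⟧-+ : ∀ a b → ⟦ a + b ⟧ ≡ ⟦ a ⟧ +ℚ ⟦ b ⟧
-- `⟦_⟧` normalises by a gcd and does not compute on variables. Among unnormalised rationals all
-- denominators here are 1.
⟦⟧-+ a b = ℚ.toℚᵘ-injective (begin-equality
  toℚᵘ ⟦ a + b ⟧                            ≃⟨ ℚ.toℚᵘ-fromℚᵘ (ℚᵘ.mkℚᵘ (ℤ.+ (a + b)) 0) ⟩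
  ℚᵘ.mkℚᵘ (ℤ.+ (a + b)) 0
    ≃⟨ ℚᵘ.*≡* (trans (ℤ.*-identityʳ (ℤ.+ (a + b))) (sym (trans (ℤ.*-identityʳ _)
         (cong₂ ℤ._+_ (ℤ.*-identityʳ (ℤ.+ a)) (ℤ.*-identityʳ (ℤ.+ b)))))) ⟩
  ℚᵘ.mkℚᵘ (ℤ.+ a) 0 ℚᵘ.+ ℚᵘ.mkℚᵘ (ℤ.+ b) 0
    ≃⟨ ℚᵘ.+-cong (ℚ.toℚᵘ-fromℚᵘ (ℚᵘ.mkℚᵘ (ℤ.+ a) 0)) (ℚ.toℚᵘ-fromℚᵘ (ℚᵘ.mkℚᵘ (ℤ.+ b) 0)) ⟨
  toℚᵘ ⟦ a ⟧ ℚᵘ.+ toℚᵘ ⟦ b ⟧              ≃⟨ ℚ.toℚᵘ-homo-+ ⟦ a ⟧ ⟦ b ⟧ ⟨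
  toℚᵘ (⟦ a ⟧ +ℚ ⟦ b ⟧)                     ∎)
  where open ℚᵘ.≤-Reasoning

0≤⟦_⟧ : ∀ m → 0ℚ ≤ℚ ⟦ m ⟧
0≤⟦ m ⟧ = ℚ.toℚᵘ-cancel-≤ (ℚᵘ.≤-respʳ-≃ (ℚᵘ.≃-sym (ℚ.toℚᵘ-fromℚᵘ (ℚᵘ.mkℚᵘ (ℤ.+ m) 0)))
  (ℚᵘ.nonNegative⁻¹ (ℚᵘ.mkℚᵘ (ℤ.+ m) 0)))

≤[]-refl : ∀ x e → x ≤[ e ] x
≤[]-refl x e = ℚ.≤-trans (ℚ.≤-reflexive (sym (ℚ.+-identityʳ x))) (ℚ.+-monoʳ-≤ x 0≤⟦ e ⟧)

≤[]-trans : ∀ x y z e f → x ≤[ e ] y → y ≤[ f ] z → x ≤[ e + f ] z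
≤[]-trans x y z e f p q = begin
  x                          ≤⟨ p ⟩
  y +ℚ ⟦ e ⟧                 ≤⟨ ℚ.+-monoˡ-≤ ⟦ e ⟧ q ⟩
  z +ℚ ⟦ f ⟧ +ℚ ⟦ e ⟧        ≡⟨ ℚ.+-assoc z ⟦ f ⟧ ⟦ e ⟧ ⟩
  z +ℚ (⟦ f ⟧ +ℚ ⟦ e ⟧)      ≡⟨ cong (z +ℚ_) (trans (sym (⟦⟧-+ f e)) (cong ⟦_⟧ (+-comm f e))) ⟩
  z +ℚ ⟦ e + f ⟧             ∎
  where open ℚ.≤-Reasoning

≤[]-mono : ∀ x y {e f} → e ≤ f → x ≤[ e ] y → x ≤[ f ] y
≤[]-mono x y {e} {f} e≤f p =
  subst (x ≤[_] y) (m+[n∸m]≡n e≤f) (≤[]-trans x y y e (f ∸ e) p (≤[]-refl y (f ∸ e)))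

-- Subsets of `Fin n` given by lists.

fromList : ∀ {n} → List (Fin n) → Subset n
fromList []       = ∅
fromList (x ∷ xs) = fromList xs [ x ]≔ inside

∈-fromList⁺ : ∀ {n} {x : Fin n} {xs} → x ∈ xs → x ∈ˢ fromList xs
∈-fromList⁺ {xs = y ∷ xs} (here refl) = []≔-updates (fromList xs) y
∈-fromList⁺ {x = x} {xs = y ∷ xs} (there x∈) with x Fin.≟ y
... | yes refl = []≔-updates (fromList xs) y
... | no x≢y = []≔-minimal (fromList xs) x y x≢y (∈-fromList⁺ x∈)

∈-fromList⁻ : ∀ {n} {x : Fin n} {xs} → x ∈ˢ fromList xs → x ∈ xs
∈-fromList⁻ {xs = []} x∈ = contradiction x∈ ∉⊥
∈-fromList⁻ {x = x} {xs = y ∷ xs} x∈ with x Fin.≟ y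
... | yes refl = here refl
... | no x≢y = there (∈-fromList⁻ (lookup⇒[]= x (fromList xs)
  (trans (sym (lookup∘update′ x≢y (fromList xs) inside)) ([]=⇒lookup x∈))))

∣insert∣ : ∀ {n} (p : Subset n) x → x ∉ˢ p → ∣ p [ x ]≔ inside ∣ ≡ suc ∣ p ∣
∣insert∣ (true  ∷ p) zero    x∉ = contradiction here x∉
∣insert∣ (false ∷ p) zero    x∉ = refl
∣insert∣ (true  ∷ p) (suc x) x∉ = cong suc (∣insert∣ p x (x∉ ∘ there))
∣insert∣ (false ∷ p) (suc x) x∉ = ∣insert∣ p x (x∉ ∘ there)

∣fromList∣ : ∀ {n} {xs : List (Fin n)} → Unique xs → ∣ fromList xs ∣ ≡ length xs
∣fromList∣ {n} [] = ∣⊥∣≡0 n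
∣fromList∣ {xs = x ∷ xs} (px ∷ u) =
  trans (∣insert∣ (fromList xs) x (Unique⇒∉ px ∘ ∈-fromList⁻)) (cong suc (∣fromList∣ u))

-- What the answers imply about the unknown values.

module _ {n : ℕ} where

  -- The valuations consistent with the answers received so far.
  Knowledge : Set₁
  Knowledge = Values n → Set

  -- A record rather than a synonym for the function type, so that unification can recover `K`, `e`
  -- and both elements.
  record _⊢_≼[_]_ (K : Knowledge) (x : Fin n) (e : ℕ) (y : Fin n) : Set where
    constructor known
    field at : ∀ val → K val → val x ≤[ e ] val y

  open _⊢_≼[_]_ public

  _⊑ᴷ_ : Knowledge → Knowledge → Set
  K′ ⊑ᴷ K = ∀ val → K′ val → K val

  private variable
    K K′ : Knowledge
    e f : ℕ
    x y z : Fin n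

  weaken : K′ ⊑ᴷ K → K ⊢ x ≼[ e ] y → K′ ⊢ x ≼[ e ] y
  weaken s p = known λ val κ → at p val (s val κ)

  ≼-refl : K ⊢ x ≼[ e ] x
  ≼-refl {x = x} {e = e} = known λ val _ → ≤[]-refl (val x) e

  ≼-mono : e ≤ f → K ⊢ x ≼[ e ] y → K ⊢ x ≼[ f ] y
  ≼-mono {x = x} {y = y} e≤f p = known λ val κ → ≤[]-mono (val x) (val y) e≤f (at p val κ)

  ≼-trans : K ⊢ x ≼[ e ] y → K ⊢ y ≼[ f ] z → K ⊢ x ≼[ e + f ] z
  ≼-trans {x = x} {e = e} {y = y} {f = f} {z = z} p q =
    known λ val κ → ≤[]-trans (val x) (val y) (val z) e f (at p val κ) (at q val κ)

  -- Correct or not, an admissible answer is true up to error 1.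
  Answered : Knowledge → Bool → Fin n → Fin n → Set
  Answered K true  x y = K ⊢ y ≼[ 1 ] x
  Answered K false x y = K ⊢ x ≼[ 1 ] y

  weakenAnswer : K′ ⊑ᴷ K → ∀ b → Answered K b x y → Answered K′ b x y
  weakenAnswer s true  = weaken s
  weakenAnswer s false = weaken s

-- Decision trees built by continuations, and the quickselect state.

module Selection (n k i : ℕ) where

  -- Correctness is relative to `K`, so a subtree only has to serve the valuations consistent with
  -- the answers on its path. The query procedures take the rest of the algorithm as a continuation
  -- and add their own cost to its depth `d`.
  Solvable : Knowledge {n} → ℕ → Set
  Solvable K d = Σ (Tree n) λ T →
    depth T ≤ d × (∀ val → K val → AlwaysOutputs val (IsKOrder val k i) T)

  private variable
    K : Knowledge {n}
    d : ℕ

  relax : ∀ {d′} → d ≤ d′ → Solvable K d → Solvable K d′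
  relax d≤d′ (T , D , C) = T , ≤-trans D d≤d′ , C

  ask : ∀ x y → (∀ b K′ → K′ ⊑ᴷ K → Answered K′ b x y → Solvable K′ d) → Solvable K (suc d)
  ask {K = K} x y cont
    with cont true  (λ val → K val × Admissible val x y) (λ _ → proj₁) (known λ _ → proj₂)
       | cont false (λ val → K val × Admissible val y x) (λ _ → proj₁) (known λ _ → proj₂)
  ... | T , D , C | T′ , D′ , C′ = node x y T T′ , s≤s (⊔-lub D D′) ,
    λ val κ → (λ a → C val (κ , a)) , (λ a → C′ val (κ , a))

  askAll : ∀ x ys →
    (∀ K′ → K′ ⊑ᴷ K → (g : Fin n → Bool) → (∀ {y} → y ∈ ys → Answered K′ (g y) x y) →
        Solvable K′ d) →
    Solvable K (length ys + d)
  askAll {K = K} x [] cont = cont K (λ _ → id) (λ _ → true) λ ()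
  askAll {K = K} {d = d} x (y ∷ ys) cont = ask x y λ b K₁ s₁ a₁ → askAll x ys λ K₂ s₂ g a₂ →
    cont K₂ (λ val → s₁ val ∘ s₂ val) (λ z → if does (z Fin.≟ y) then b else g z)
        (answers b g (weakenAnswer s₂ b a₁) a₂)
    where
    answers : ∀ b g {K₂} → Answered K₂ b x y → (∀ {y} → y ∈ ys → Answered K₂ (g y) x y) →
      ∀ {z} → z ∈ y ∷ ys → Answered K₂ (if does (z Fin.≟ y) then b else g z) x z
    answers b g a₁ a₂ {z} z∈ with z Fin.≟ y | z∈
    ... | yes refl | _ = a₁
    ... | no z≢y   | here z≡y = contradiction z≡y z≢y
    ... | no z≢y   | there z∈ys = a₂ z∈ys

  IsTournament : Knowledge {n} → (Fin n → Fin n → Bool) → List (Fin n) → Set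
  IsTournament K R xs = ∀ {x y} → x ∈ xs → y ∈ xs → x ≢ y →
    Answered K (R x y) x y × R y x ≡ not (R x y)

  -- Each unordered pair is queried once, the head against the tail and then the tail within itself.
  -- The opposite orientation is defined by negation, which makes `R` antisymmetric.
  tournament : ∀ xs → (∀ K′ → K′ ⊑ᴷ K → ∀ R → IsTournament K′ R xs → Solvable K′ d) →
    Solvable K (triangle (length xs) + d)
  tournament {K = K} [] cont = cont K (λ _ → id) (λ _ _ → true) λ ()
  tournament {d = d} (x ∷ xs) cont = relax (≤-reflexive
      (sym (+-assoc (length xs) (triangle (length xs)) d)))
    (askAll x xs λ K₁ s₁ g a₁ → tournament xs λ K₂ s₂ R a₂ →
      cont K₂ (λ val → s₁ val ∘ s₂ val) (extend g R)
          (extended g R (λ {y} → weakenAnswer s₂ (g y) ∘ a₁) a₂))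
    where
    extend : (Fin n → Bool) → (Fin n → Fin n → Bool) → Fin n → Fin n → Bool
    extend g R y z = if does (y Fin.≟ x) then g z else if does (z Fin.≟ x) then not (g y) else R y z

    flip-answer : ∀ {K : Knowledge {n}} {y z} b → Answered K b y z → Answered K (not b) z y
    flip-answer true  a = a
    flip-answer false a = a

    ∈-tail : ∀ {y} → y ≢ x → y ∈ x ∷ xs → y ∈ xs
    ∈-tail y≢x (here y≡x) = contradiction y≡x y≢x
    ∈-tail y≢x (there y∈) = y∈

    extended : ∀ g R {K} → (∀ {y} → y ∈ xs → Answered K (g y) x y) → IsTournament K R xs →
      IsTournament K (extend g R) (x ∷ xs)
    extended g R a₁ a₂ {y} {z} y∈ z∈ y≢z with y Fin.≟ x | z Fin.≟ x
    ... | yes refl | yes refl = contradiction refl y≢z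
    ... | yes refl | no z≢x   = a₁ (∈-tail z≢x z∈) , refl
    ... | no y≢x   | yes refl = flip-answer (g y) (a₁ (∈-tail y≢x y∈)) , sym (Bool.not-involutive (g y))
    ... | no y≢x   | no z≢x   = a₂ (∈-tail y≢x y∈) (∈-tail z≢x z∈) y≢z

  record State (K : Knowledge) (Y : List (Fin n)) : Set where
    field
      lower upper : List (Fin n)
      perm  : lower ++ Y ++ upper ↭ allFin n
      lower≼Y     : ∀ {a b} → a ∈ lower → b ∈ Y → K ⊢ a ≼[ k ] b
      lower≼upper : ∀ {a b} → a ∈ lower → b ∈ upper → K ⊢ a ≼[ k ] b
      Y≼upper     : ∀ {a b} → a ∈ Y → b ∈ upper → K ⊢ a ≼[ k ] b
      rank>lower  : length lower < i
      rank≤Y      : i ≤ length lower + length Y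

  open State

  weakenState : ∀ {K′ Y} → K′ ⊑ᴷ K → State K Y → State K′ Y
  weakenState s S = record
    { lower = lower S ; upper = upper S ; perm = perm S
    ; lower≼Y     = λ a∈ b∈ → weaken s (lower≼Y S a∈ b∈)
    ; lower≼upper = λ a∈ b∈ → weaken s (lower≼upper S a∈ b∈)
    ; Y≼upper     = λ a∈ b∈ → weaken s (Y≼upper S a∈ b∈)
    ; rank>lower = rank>lower S ; rank≤Y = rank≤Y S }

  State⇒Unique : ∀ {Y} → State K Y → Unique Y
  State⇒Unique {Y = Y} S = proj₁ (Unique-++⁻ Y (proj₁ (proj₂
    (Unique-++⁻ (lower S) (Unique-resp (↭-sym (perm S)) (allFin⁺ n))))))

  -- The part that cannot contain rank `i` joins `lower` or `upper`. Any two elements are separated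
  -- by one cut only, and that cut relates them directly, so the error `k` does not accumulate over
  -- cuts.
  cut : ∀ {Y} {P : Fin n → Set} (P? : Decidable P) →
    (∀ {a b} → a ∈ Y → b ∈ Y → P a → ¬ P b → K ⊢ a ≼[ k ] b) →
    State K Y → State K (filter P? Y) ⊎ State K (filter (∁? P?) Y)
  cut {K = K} {Y = Y} {P = P} P? P≼∁P S = decide (i ≤? length (lower S) + length P⁺)
    where
    P⁺ = filter P? Y
    P⁻ = filter (∁? P?) Y
    from⁺ : ∀ {a} → a ∈ P⁺ → a ∈ Y × P a
    from⁺ = ∈-filter⁻ P?
    from⁻ : ∀ {a} → a ∈ P⁻ → a ∈ Y × ¬ P a
    from⁻ = ∈-filter⁻ (∁? P?)
    ⁺≼⁻ : ∀ {a b} → a ∈ P⁺ → b ∈ P⁻ → K ⊢ a ≼[ k ] b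
    ⁺≼⁻ a∈ b∈ = P≼∁P (proj₁ (from⁺ a∈)) (proj₁ (from⁻ b∈)) (proj₂ (from⁺ a∈)) (proj₂ (from⁻ b∈))
    perm′ : lower S ++ P⁺ ++ P⁻ ++ upper S ↭ allFin n
    perm′ = ↭-trans (++⁺ˡ (lower S) (↭-trans (↭-sym (++-assoc P⁺ P⁻ (upper S)))
      (++⁺ʳ (upper S) (filter-∁-↭ P? Y)))) (perm S)
    length-Y : length Y ≡ length P⁺ + length P⁻
    length-Y = trans (sym (↭-length (filter-∁-↭ P? Y))) (length-++ P⁺)
    decide : Dec (i ≤ length (lower S) + length P⁺) → State K P⁺ ⊎ State K P⁻
    decide (yes i≤) = inj₁ record
      { lower = lower S ; upper = P⁻ ++ upper S
      ; perm = perm′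
      ; lower≼Y = λ a∈ b∈ → lower≼Y S a∈ (proj₁ (from⁺ b∈))
      ; lower≼upper = λ a∈ → [ lower≼Y S a∈ ∘ proj₁ ∘ from⁻ , lower≼upper S a∈ ]′ ∘ ∈-++⁻ P⁻
      ; Y≼upper = λ a∈ → [ ⁺≼⁻ a∈ , Y≼upper S (proj₁ (from⁺ a∈)) ]′ ∘ ∈-++⁻ P⁻
      ; rank>lower = rank>lower S ; rank≤Y = i≤ }
    decide (no i≰) = inj₂ record
      { lower = lower S ++ P⁺ ; upper = upper S
      ; perm = ↭-trans (++-assoc (lower S) P⁺ _) perm′
      ; lower≼Y = λ a∈ b∈ →
          [ (λ a∈l → lower≼Y S a∈l (proj₁ (from⁻ b∈))) , (λ a∈⁺ → ⁺≼⁻ a∈⁺ b∈) ]′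
              (∈-++⁻ (lower S) a∈)
      ; lower≼upper = λ a∈ b∈ →
          [ (λ a∈l → lower≼upper S a∈l b∈) , (λ a∈⁺ → Y≼upper S (proj₁ (from⁺ a∈⁺)) b∈) ]′
            (∈-++⁻ (lower S) a∈)
      ; Y≼upper = λ a∈ b∈ → Y≼upper S (proj₁ (from⁻ a∈)) b∈
      ; rank>lower = subst (_< i) (sym (length-++ (lower S))) (≰⇒> i≰)
      ; rank≤Y = ≤-trans (rank≤Y S) (≤-reflexive (trans (cong (length (lower S) +_) length-Y)
          (trans (sym (+-assoc (length (lower S)) (length P⁺) (length P⁻)))
            (cong (_+ length P⁻) (sym (length-++ (lower S))))))) }

  output : ∀ {x} → State K (x ∷ []) → Solvable K d
  output {x = x} S = leaf x , z≤n , λ val κ →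
    -- The witness is `lower`: its complement consists of `x` and `upper`, and the two rank bounds
    -- force `i = length lower + 1`.
    fromList (lower S) , (λ x∈ → Unique⇒∉ x∉rest (∈-++⁺ˡ {xs = lower S} (∈-fromList⁻ x∈))) ,
    trans (∣fromList∣ lower-unique) (cong (_∸ 1) (sym rank≡)) , order val κ
    where
    unique : Unique (x ∷ lower S ++ upper S)
    unique = Unique-resp (shift x (lower S) (upper S)) (Unique-resp (↭-sym (perm S)) (allFin⁺ n))
    x∉rest = AllPairs.head unique
    lower-unique : Unique (lower S)
    lower-unique = proj₁ (Unique-++⁻ (lower S) (AllPairs.tail unique))
    rank≡ : i ≡ suc (length (lower S))
    rank≡ = ≤-antisym (≤-trans (rank≤Y S) (≤-reflexive (+-comm (length (lower S)) 1)))
        (rank>lower S)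
    outside-lower : ∀ {b} → b ∉ˢ fromList (lower S) → b ≡ x ⊎ b ∈ upper S
    outside-lower {b} b∉ with ∈-++⁻ (lower S) (∈-resp-↭ (↭-sym (perm S)) (∈-allFin b))
    ... | inj₁ b∈ = contradiction (∈-fromList⁺ b∈) b∉
    ... | inj₂ (here b≡x) = inj₁ b≡x
    ... | inj₂ (there b∈) = inj₂ b∈
    order : ∀ val → _ → ∀ a b → (a ∈ˢ fromList (lower S) ⊎ a ≡ x) → b ∉ˢ fromList (lower S) →
        val a ≤[ k ] val b
    order val κ a b a∈ b∉ with a∈ | outside-lower b∉
    ... | inj₁ a∈l | inj₁ refl = at (lower≼Y S (∈-fromList⁻ a∈l) (here refl)) val κ
    ... | inj₁ a∈l | inj₂ b∈u = at (lower≼upper S (∈-fromList⁻ a∈l) b∈u) val κ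
    ... | inj₂ refl | inj₁ refl = ≤[]-refl (val x) k
    ... | inj₂ refl | inj₂ b∈u = at (Y≼upper S (here refl) b∈u) val κ

  State-nonempty : State K [] → Solvable K d
  State-nonempty S = contradiction (≤-trans (rank≤Y S) (≤-reflexive (+-identityʳ _)))
      (<⇒≱ (rank>lower S))

  -- `Y` has no duplicates, so at most one entry is left; the rank bounds rule out none.
  output-only : ∀ {Y} z → (∀ {y} → y ∈ Y → y ≡ z) → State K Y → Solvable K d
  output-only {Y = []} z _ S = State-nonempty S
  output-only {Y = y ∷ []} z _ S = output S
  output-only {Y = y ∷ y′ ∷ Y} z only S = contradiction
    (trans (only (here refl)) (sym (only (there (here refl)))))
    (All.head (AllPairs.head (State⇒Unique S)))

-- Integer roots and the size of a tournament window.

floor-root : ∀ m n → 1 ≤ m → ∃ λ r → r ^ m ≤ n × n < suc r ^ m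
floor-root (suc m) zero _ = 0 , z≤n , subst (0 <_) (sym (^-zeroˡ (suc m))) (s≤s z≤n)
floor-root m (suc n) 1≤m with floor-root m n 1≤m
... | r , lo , hi with suc r ^ m ≤? suc n
... | yes p = suc r , p , ≤-<-trans hi (^-monoˡ-< m {{>-nonZero 1≤m}} (n<1+n (suc r)))
... | no ¬p = r , m≤n⇒m≤1+n lo , ≰⇒> ¬p

^-distribʳ-* : ∀ m a b → (a * b) ^ m ≡ a ^ m * b ^ m
^-distribʳ-* zero    a b = refl
^-distribʳ-* (suc m) a b = trans (cong (a * b *_) (^-distribʳ-* m a b))
  (solve 4 (λ a b x y → a :* b :* (x :* y) := a :* x :* (b :* y)) refl a b (a ^ m) (b ^ m))

-- A tournament on `4h + 1` centres has `2h (4h + 1)` pairs, which is at most `4h` for each of the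
-- `2h + 1` pivots it consumes. The other `l` pivots keep their allowance of `4h` each.
triangle-window : ∀ h l → triangle (suc (4 * h)) + 4 * h * l ≤ 4 * h * (suc (2 * h) + l)
triangle-window h l = begin
  triangle (suc (4 * h)) + 4 * h * l
    ≤⟨ +-monoˡ-≤ (4 * h * l) (*-cancelˡ-≤ {triangle (suc (4 * h))} {4 * h * suc (2 * h)} 2 double) ⟩
  4 * h * suc (2 * h) + 4 * h * l             ≡⟨ *-distribˡ-+ (4 * h) (suc (2 * h)) l ⟨
  4 * h * (suc (2 * h) + l)                   ∎
  where
  open ≤-Reasoning
  double : 2 * triangle (suc (4 * h)) ≤ 2 * (4 * h * suc (2 * h))
  double = begin
    2 * triangle (suc (4 * h))     ≡⟨ 2*triangle (4 * h) ⟩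
    4 * h * suc (4 * h)            ≤⟨ m≤m+n _ (4 * h) ⟩
    4 * h * suc (4 * h) + 4 * h
      ≡⟨ solve 1 (λ h → con 4 :* h :* (con 1 :+ con 4 :* h) :+ con 4 :* h := con 2 :*
          (con 4 :* h :* (con 1 :+ con 2 :* h))) refl h ⟩
    2 * (4 * h * suc (2 * h))      ∎

-- A level with parameter h would leave too few pivots if 12h + 4 > L; it is then run with a
-- smaller h′, so that between 4 and 15 pivots result.
WindowSize : ℕ → ℕ → ℕ → Set
WindowSize h L h′ = 1 ≤ h′ × h′ ≤ h × 12 * h′ + 4 ≤ L × (h′ ≡ h ⊎ L ≤ 12 * h′ + 15)

division : ∀ d L → ∃ λ q → suc d * q ≤ L × L ≤ suc d * q + d
division d zero = 0 , ≤-reflexive (*-zeroʳ d) , z≤n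
division d (suc L) with division d L
... | q , lo , hi with suc L ≤? suc d * q + d
... | yes p = q , m≤n⇒m≤1+n lo , p
... | no ¬p = suc q , ≤-trans next (≰⇒> ¬p) , ≤-trans (s≤s hi)
    (≤-trans (≤-reflexive (sym (+-suc _ d)))
                (≤-trans (≤-reflexive (trans (+-comm _ (suc d)) (sym (*-suc (suc d) q))))
                    (m≤m+n _ d)))
  where
  next : suc d * suc q ≤ suc (suc d * q + d)
  next = ≤-reflexive (trans (*-suc (suc d) q)
      (trans (+-comm (suc d) (suc d * q)) (+-suc (suc d * q) d)))

windowSize : ∀ h L → 1 ≤ h → 24 ≤ L → ∃ (WindowSize h L)
windowSize h L 1≤h 24≤L with 12 * h + 4 ≤? L | division 11 (L ∸ 4)
... | yes fits | _ = h , 1≤h , ≤-refl , fits , inj₁ refl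
-- Here `q` is `L - 4` divided by 12, with remainder at most 11, hence `L ≤ 12q + 15`; then `24 ≤ L`
-- excludes `q = 0`. From `12q + 4 ≤ L < 12h + 4` follows `q ≤ h`.
... | no ¬fits | q , lo , hi = q , 1≤q q upper ,
    *-cancelˡ-≤ 12 (+-cancelʳ-≤ 4 (12 * q) (12 * h)
        (≤-trans lower (<⇒≤ (≰⇒> ¬fits)))) , lower , inj₂ upper
  where
  4≤L : 4 ≤ L
  4≤L = ≤-trans (m≤m+n 4 20) 24≤L
  lower : 12 * q + 4 ≤ L
  lower = ≤-trans (+-monoˡ-≤ 4 lo) (≤-reflexive (m∸n+n≡m 4≤L))
  upper : L ≤ 12 * q + 15
  upper = ≤-trans (≤-reflexive (sym (m∸n+n≡m 4≤L)))
      (≤-trans (+-monoˡ-≤ 4 hi) (≤-reflexive (+-assoc (12 * q) 11 4)))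
  1≤q : ∀ q → L ≤ 12 * q + 15 → 1 ≤ q
  1≤q zero    L≤15 = contradiction (≤-trans 24≤L L≤15) (<⇒≱ (m≤m+n 16 8))
  1≤q (suc _) _ = s≤s z≤n

-- Sizes, counts and costs within one phase.

module Accounting (m r N : ℕ) (4≤r : 4 ≤ r) where

  -- L pivots with sets of size v, and j levels left, the next one with parameter h.  A level leaves
  -- up to 4h of its L pivots over; as L + 2 ≤ (2h + 1)(L′ + 2), adding 2 absorbs this loss.
  record Invariant (j h v L : ℕ) : Set where
    field
      h-positive : 1 ≤ h
      mass       : 2 * N ≤ 3 * m * (suc v * L)
      potential  : (N + 2) * 2 ^ j ≤ m * (suc v * (L + 2))
      shrinking  : L ≤ 6 * r ⊎ L * h ≤ suc r * h ^ (2 ^ j)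

  open Invariant

  24≤6r : 24 ≤ 6 * r
  24≤6r = *-monoʳ-≤ 6 4≤r

  -- With no level left the exponent `2 ^ 0` is 1, so the second case of `shrinking` reads
  -- `L ≤ r + 1`.
  exhausted : ∀ {h v L} → Invariant 0 h v L → L ≤ 6 * r
  exhausted {h} {v} {L} I with shrinking I
  ... | inj₁ L≤ = L≤
  ... | inj₂ Lh≤ = ≤-trans (*-cancelʳ-≤ L (suc r) h {{>-nonZero (h-positive I)}}
                     (≤-trans Lh≤ (≤-reflexive (cong (suc r *_) (*-identityʳ h)))))
                   (≤-trans (+-monoˡ-≤ r (≤-trans (s≤s z≤n) 4≤r)) (+-monoʳ-≤ r (m≤m+n r (4 * r))))

  -- A level multiplies `suc v` by `h′ + 1` and `L + 2` by at least `1 / (2h′ + 1)`. As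
  -- `2h′ + 1 ≤ 2 (h′ + 1)`, their product loses at most a factor 2, which the drop from `2 ^ suc j`
  -- to `2 ^ j` pays for.
  next : ∀ {j h v L h′ L′} → Invariant (suc j) h v L → 6 * r < L → WindowSize h L h′ →
    L′ * suc (2 * h′) ≤ L → L + 2 ≤ suc (2 * h′) * (L′ + 2) →
    Invariant j (h′ * h′) (v + h′ * suc v) L′
  next {j} {h} {v} {L} {h′} {L′} I big (1≤h′ , h′≤h , fits , full) L′≤ L≤ = record
    { h-positive = *-mono-≤ 1≤h′ 1≤h′
    ; mass = mass′ ; potential = potential′ ; shrinking = shrinking′ full }
    where
    open ≤-Reasoning
    -- The constants of `WindowSize` come from here: `12h′ + 4 + 2` is six times `2h′ + 1`.
    4≤L′ : 4 ≤ L′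
    4≤L′ = +-cancelʳ-≤ 2 4 L′ (*-cancelˡ-≤ (suc (2 * h′)) (begin
      suc (2 * h′) * 6
        ≡⟨ solve 1 (λ h → (con 1 :+ con 2 :* h) :* con 6 := con 12 :* h :+ con 4 :+ con 2) refl h′ ⟩
      12 * h′ + 4 + 2         ≤⟨ +-monoˡ-≤ 2 fits ⟩
      L + 2                   ≤⟨ L≤ ⟩
      suc (2 * h′) * (L′ + 2) ∎))
    w′ = suc h′ * suc v
    potential′ : (N + 2) * 2 ^ j ≤ m * (w′ * (L′ + 2))
    potential′ = *-cancelˡ-≤ 2 (begin
      2 * ((N + 2) * 2 ^ j)
        ≡⟨ solve 2 (λ a b → con 2 :* (a :* b) := a :* (con 2 :* b)) refl (N + 2) (2 ^ j) ⟩
      (N + 2) * 2 ^ suc j                          ≤⟨ potential I ⟩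
      m * (suc v * (L + 2))
        ≤⟨ *-monoʳ-≤ m (*-monoʳ-≤ (suc v) (≤-trans L≤
            (*-monoˡ-≤ (L′ + 2) (n≤1+n (suc (2 * h′)))))) ⟩
      m * (suc v * ((2 + 2 * h′) * (L′ + 2)))
        ≡⟨ solve 4 (λ m v h l → m :* (v :* ((con 2 :+ con 2 :* h) :* l)) := con 2 :*
            (m :* ((con 1 :+ h) :* v :* l))) refl m (suc v) h′ (L′ + 2) ⟩
      2 * (m * (w′ * (L′ + 2)))                    ∎)
    -- The 2 added in the potential is removed at the cost of a factor 3/2: `2 (L′ + 2) ≤ 3 L′`
    -- because `4 ≤ L′`.
    mass′ : 2 * N ≤ 3 * m * (w′ * L′)
    mass′ = begin
      2 * N                          ≤⟨ *-monoʳ-≤ 2 (m≤m+n N 2) ⟩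
      2 * (N + 2)                    ≤⟨ *-monoʳ-≤ 2 (m≤m*n (N + 2) (2 ^ j) {{m^n≢0 2 j}}) ⟩
      2 * ((N + 2) * 2 ^ j)          ≤⟨ *-monoʳ-≤ 2 potential′ ⟩
      2 * (m * (w′ * (L′ + 2)))
        ≡⟨ solve 3 (λ m w l → con 2 :* (m :* (w :* (l :+ con 2))) := m :*
            (w :* (con 2 :* l :+ con 4))) refl m w′ L′ ⟩
      m * (w′ * (2 * L′ + 4))        ≤⟨ *-monoʳ-≤ m (*-monoʳ-≤ w′ (+-monoʳ-≤ (2 * L′) 4≤L′)) ⟩
      m * (w′ * (2 * L′ + L′))
        ≡⟨ solve 3 (λ m w l → m :* (w :* (con 2 :* l :+ l)) := con 3 :* m :* (w :* l))
            refl m w′ L′ ⟩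
      3 * m * (w′ * L′)              ∎
    -- After a reduced window at most 15 pivots remain, fewer than `6 * r`. After a full one,
    -- `L′ h² ≤ L h`, and squaring `h` halves the exponent.
    shrinking′ : h′ ≡ h ⊎ L ≤ 12 * h′ + 15 → L′ ≤ 6 * r ⊎ L′ * (h′ * h′) ≤ suc r * (h′ * h′) ^
        (2 ^ j)
    shrinking′ (inj₂ L≤15) = inj₁ (≤-trans (*-cancelʳ-≤ L′ 15 (suc (2 * h′)) (begin
      L′ * suc (2 * h′)      ≤⟨ L′≤ ⟩
      L                      ≤⟨ L≤15 ⟩
      12 * h′ + 15           ≤⟨ m≤m+n _ (18 * h′) ⟩
      12 * h′ + 15 + 18 * h′
        ≡⟨ solve 1 (λ h → con 12 :* h :+ con 15 :+ con 18 :* h := con 15 :* (con 1 :+ con 2 :* h))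
            refl h′ ⟩
      15 * suc (2 * h′)      ∎)) (≤-trans (m≤m+n 15 9) 24≤6r))
    shrinking′ (inj₁ refl) with shrinking I
    ... | inj₁ L≤6r = contradiction L≤6r (<⇒≱ big)
    ... | inj₂ Lh≤ = inj₂ (begin
      L′ * (h * h)                   ≡⟨ *-assoc L′ h h ⟨
      L′ * h * h
        ≤⟨ *-monoˡ-≤ h (≤-trans (*-monoʳ-≤ L′ (≤-trans (m≤m+n h (h + 0)) (n≤1+n _))) L′≤) ⟩
      L * h                          ≤⟨ Lh≤ ⟩
      suc r * h ^ (2 * 2 ^ j)        ≡⟨ cong (suc r *_) (^-*-assoc h 2 (2 ^ j)) ⟨
      suc r * (h * (h * 1)) ^ 2 ^ j  ≡⟨ cong (λ x → suc r * (h * x) ^ 2 ^ j) (*-identityʳ h) ⟩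
      suc r * (h * h) ^ 2 ^ j        ∎)

  -- Geometric decay: the parameter squares while the number of pivots drops by a factor `2h + 1`,
  -- so all later levels together fit into `4 * h * L`, the bound for the present one. Together they
  -- give the 8 of `levels-cost`.
  next-levels-cost : ∀ {L L′} h D → L′ * suc (2 * h) ≤ L → 8 * (h * h) * L′ + D ≤ 4 * h * L + D
  next-levels-cost {L} {L′} h D L′≤ = +-monoˡ-≤ D (begin
    8 * (h * h) * L′
      ≡⟨ solve 2 (λ h L′ → con 8 :* (h :* h) :* L′ := con 4 :* h :* (L′ :* (con 2 :* h)))
          refl h L′ ⟩
    4 * h * (L′ * (2 * h))       ≤⟨ *-monoʳ-≤ (4 * h) (≤-trans (*-monoʳ-≤ L′ (n≤1+n (2 * h))) L′≤) ⟩
    4 * h * L                    ∎)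
    where open ≤-Reasoning

  levels-cost : ∀ {h h′} L D → h′ ≤ h → 4 * h′ * L + (4 * h′ * L + D) ≤ 8 * h * L + D
  levels-cost {h} {h′} L D h′≤h = begin
    4 * h′ * L + (4 * h′ * L + D)
      ≡⟨ solve 3 (λ h L D → con 4 :* h :* L :+ (con 4 :* h :* L :+ D) := con 8 :* h :* L :+ D)
          refl h′ L D ⟩
    8 * h′ * L + D                   ≤⟨ +-monoˡ-≤ D (*-monoˡ-≤ L (*-monoʳ-≤ 8 h′≤h)) ⟩
    8 * h * L + D                    ∎
    where open ≤-Reasoning

  -- Free of division, the conclusion says that at least `2N / (3m)` elements are discarded.
  remaining : ∀ {v L N′} → 2 * N ≤ 3 * m * (suc v * L) → N′ + L * suc v ≤ N →
      3 * m * N′ + 2 * N ≤ 3 * m * N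
  remaining {v} {L} {N′} mass counted = begin
    3 * m * N′ + 2 * N                   ≤⟨ +-monoʳ-≤ (3 * m * N′) mass ⟩
    3 * m * N′ + 3 * m * (suc v * L)     ≡⟨ *-distribˡ-+ (3 * m) N′ (suc v * L) ⟨
    3 * m * (N′ + suc v * L)
      ≤⟨ *-monoʳ-≤ (3 * m) (subst (λ x → N′ + x ≤ N) (*-comm L (suc v)) counted) ⟩
    3 * m * N                            ∎
    where open ≤-Reasoning

  -- Single elements have `v = 0`. Then `m = 2 ^ j` makes the potential an equality, and `shrinking`
  -- is the upper bound on `N` multiplied by `suc r`.
  initial : ∀ j → m ≡ 2 ^ j → N ≤ suc r ^ m → Invariant j (suc r) 0 N
  initial j refl N≤ = record
    { h-positive = s≤s z≤n
    ; mass = *-mono-≤ {2} {3 * m} {N} (≤-trans (m≤m+n 2 1) (*-monoʳ-≤ 3 (m^n>0 2 j)))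
        (≤-reflexive (sym (+-identityʳ N)))
    ; potential = ≤-reflexive (trans (*-comm (N + 2) m) (cong (m *_) (sym (+-identityʳ (N + 2)))))
    ; shrinking = inj₂ (≤-trans (*-monoˡ-≤ (suc r) N≤) (≤-reflexive (*-comm (suc r ^ m) (suc r)))) }

  smaller : ∀ {N′} → 1 ≤ N → 3 * m * N′ + 2 * N ≤ 3 * m * N → N′ < N
  smaller {N′} 1≤N removed = *-cancelˡ-< (3 * m) N′ N (<-≤-trans
    (m<m+n (3 * m * N′) (≤-trans 1≤N (m≤m+n N _))) removed)

  -- A phase may spend `16 * r * N`, that is `24 * m * r` for each of `2N / (3m)` discarded
  -- elements.
  next-budget : ℕ
  next-budget = 24 * m * r * N ∸ 16 * r * N

  remaining-budget : ∀ {N′} → 3 * m * N′ + 2 * N ≤ 3 * m * N → 24 * m * r * N′ ≤ next-budget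
  remaining-budget {N′} removed = m+n≤o⇒m≤o∸n (24 * m * r * N′) (begin
    24 * m * r * N′ + 16 * r * N
      ≡⟨ solve 4 (λ m r x y → con 24 :* m :* r :* x :+ con 16 :* r :* y := con 8 :* r :*
          (con 3 :* m :* x :+ con 2 :* y)) refl m r N′ N ⟩
    8 * r * (3 * m * N′ + 2 * N)        ≤⟨ *-monoʳ-≤ (8 * r) removed ⟩
    8 * r * (3 * m * N)
      ≡⟨ solve 3 (λ m r y → con 8 :* r :* (con 3 :* m :* y) := con 24 :* m :* r :* y) refl m r N ⟩
    24 * m * r * N                      ∎)
    where open ≤-Reasoning

  -- Levels and sweep cost `8 (r + 1) + 6 r` per element, at most `16 r` because `4 ≤ r`.
  phase-budget : 1 ≤ m → 8 * suc r * N + (6 * r * N + next-budget) ≤ 24 * m * r * N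
  phase-budget 1≤m = begin
    8 * suc r * N + (6 * r * N + next-budget)
      ≡⟨ solve 3 (λ r y D → con 8 :* (con 1 :+ r) :* y :+ (con 6 :* r :* y :+ D) :=
          (con 8 :+ con 14 :* r) :* y :+ D) refl r N next-budget ⟩
    (8 + 14 * r) * N + next-budget
      ≤⟨ +-monoˡ-≤ next-budget (*-monoˡ-≤ N (+-monoˡ-≤ (14 * r) (*-monoʳ-≤ 2 4≤r))) ⟩
    (2 * r + 14 * r) * N + next-budget
      ≡⟨ cong (λ x → x * N + next-budget) (*-distribʳ-+ r 2 14) ⟨
    16 * r * N + next-budget
      ≡⟨ m+[n∸m]≡n (*-monoˡ-≤ N (*-monoˡ-≤ r (≤-trans (m≤m+n 16 8) (*-monoʳ-≤ 24 1≤m)))) ⟩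
    24 * m * r * N                              ∎
    where open ≤-Reasoning

-- Submultisets, pivots and their merging.

_≲_ : List A → List A → Set
xs ≲ ys = ∃ λ zs → xs ++ zs ↭ ys

≲-trans : {xs ys zs : List A} → xs ≲ ys → ys ≲ zs → xs ≲ zs
≲-trans {xs = xs} (as , p) (bs , q) = as ++ bs , ↭-trans (↭-sym (++-assoc xs as bs))
    (↭-trans (++⁺ʳ bs p) q)

≲-++ : {xs xs′ ys ys′ : List A} → xs ≲ ys → xs′ ≲ ys′ → (xs ++ xs′) ≲ (ys ++ ys′)
≲-++ {xs = xs} {xs′} (as , p) (bs , q) = as ++ bs , ↭-trans
  (prove 4 ((w ⊕ x) ⊕ (y ⊕ z)) ((w ⊕ y) ⊕ (x ⊕ z)) (xs ∷ xs′ ∷ as ∷ bs ∷ [])) (++⁺ p q)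
  where
  open CommutativeMonoidSolver ++-commutativeMonoid
  w = var zero
  x = var (suc zero)
  y = var (suc (suc zero))
  z = var (suc (suc (suc zero)))

≲-Unique : {xs ys : List A} → xs ≲ ys → Unique ys → Unique xs
≲-Unique {xs = xs} (_ , p) u = proj₁ (Unique-++⁻ xs (Unique-resp (↭-sym p) u))

≲-∈ : {xs ys : List A} → xs ≲ ys → ∀ {x} → x ∈ xs → x ∈ ys
≲-∈ (_ , p) x∈ = ∈-resp-↭ p (∈-++⁺ˡ x∈)

record Pivot (n : ℕ) : Set where
  field
    centre : Fin n
    below above : List (Fin n)

  region downset upset : List (Fin n)
  region  = centre ∷ below ++ above
  downset = centre ∷ below
  upset   = centre ∷ above

open Pivot

-- `v` leaves out the centre: a discarded half has `suc v` elements, and it is `suc v` that grows by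
-- a factor `h + 1` per level.
record Certified {n} (K : Knowledge {n}) (e v : ℕ) (p : Pivot n) : Set where
  field
    below-length : length (below p) ≡ v
    above-length : length (above p) ≡ v
    below≼ : ∀ {x} → x ∈ below p → K ⊢ x ≼[ e ] centre p
    ≼above : ∀ {x} → x ∈ above p → K ⊢ centre p ≼[ e ] x

open Certified

regions : ∀ {n} → List (Pivot n) → List (Fin n)
regions = concatMap region

weakenCertified : ∀ {n e v} {K K′ : Knowledge {n}} {p} → K′ ⊑ᴷ K → Certified K e v p →
    Certified K′ e v p
weakenCertified s c = record
  { below-length = below-length c ; above-length = above-length c
  ; below≼ = weaken s ∘ below≼ c ; ≼above = weaken s ∘ ≼above c }

centres≲regions : ∀ {n} (ps : List (Pivot n)) → map centre ps ≲ regions ps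
centres≲regions [] = [] , ↭-refl
centres≲regions (p ∷ ps) = ≲-++ {xs = [ centre p ]} (below p ++ above p , ↭-refl)
    (centres≲regions ps)

concatMap-≲ : {B : Set} {f g : A → List B} → (∀ x → f x ≲ g x) → ∀ xs →
    concatMap f xs ≲ concatMap g xs
concatMap-≲ h [] = [] , ↭-refl
concatMap-≲ h (x ∷ xs) = ≲-++ (h x) (concatMap-≲ h xs)

length-concatMap : {B : Set} {f : A → List B} {c : ℕ} (xs : List A) →
    (∀ {x} → x ∈ xs → length (f x) ≡ c) →
  length (concatMap f xs) ≡ length xs * c
length-concatMap [] h = refl
length-concatMap {f = f} (x ∷ xs) h = trans (length-++ (f x))
    (cong₂ _+_ (h (here refl)) (length-concatMap xs (h ∘ there)))

-- A pivot below `p` contributes only its centre and lower half, one above only its centre and upper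
-- half. The opposite halves are not related to the new centre and are dropped, so regions are
-- preserved only up to `≲`.
merge : ∀ {n} → Pivot n → List (Pivot n) → List (Pivot n) → Pivot n
merge p us ds = record
  { centre = centre p
  ; below  = below p ++ concatMap downset ds
  ; above  = above p ++ concatMap upset us }

merge-region : ∀ {n} (p : Pivot n) us ds → region (merge p us ds) ≲ regions (p ∷ us ++ ds)
merge-region p us ds = ≲-trans
  ([] , prove 5 ((((c ⊕ (b ⊕ d)) ⊕ (a ⊕ u))) ⊕ id′) ((c ⊕ (b ⊕ a)) ⊕ (u ⊕ d))
     ([ centre p ] ∷ below p ∷ concatMap downset ds ∷ above p ∷ concatMap upset us ∷ []))
  (≲-++ {xs = region p} ([] , ++-identityʳ (region p))
     (≲-trans (≲-++ (concatMap-≲ upset≲ us) (concatMap-≲ downset≲ ds))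
        ([] , ↭-reflexive (trans (List.++-identityʳ _) (sym (List.concatMap-++ region us ds))))))
  where
  open CommutativeMonoidSolver ++-commutativeMonoid renaming (id to id′)
  c = var zero
  b = var (suc zero)
  d = var (suc (suc zero))
  a = var (suc (suc (suc zero)))
  u = var (suc (suc (suc (suc zero))))
  upset≲ : ∀ q → upset q ≲ region q
  upset≲ q = below q , prep (centre q) (++-comm (above q) (below q))
  downset≲ : ∀ q → downset q ≲ region q
  downset≲ q = above q , ↭-refl

Dominates : ∀ {n} → Knowledge {n} → Pivot n → Pivot n → Set
Dominates K p q = K ⊢ centre q ≼[ 1 ] centre p

∈-concatMap⁻′ : {B : Set} {f : A → List B} {y : B} (xs : List A) → y ∈ concatMap f xs → ∃ λ x →
    x ∈ xs × y ∈ f x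
∈-concatMap⁻′ {f = f} xs y∈ = find (∈-concatMap⁻ f {xs = xs} y∈)

-- An absorbed element reaches its old centre with error `e`, and that centre reaches the new one
-- with error 1.
merge-certified : ∀ {n e v h} {K : Knowledge {n}} {p us ds} →
  Certified K e v p → All (Certified K e v) us → All (Certified K e v) ds →
  length us ≡ h → length ds ≡ h → All (λ u → Dominates K u p) us → All (Dominates K p) ds →
  Certified K (suc e) (v + h * suc v) (merge p us ds)
merge-certified {e = e} {v} {h} {K} {p} {us} {ds} cp cus cds |us| |ds| p≼us ds≼p = record
  { below-length = trans (length-++ (below p)) (cong₂ _+_ (below-length cp)
      (trans (length-concatMap ds λ d∈ → cong suc (below-length (All.lookup cds d∈)))
          (cong (_* suc v) |ds|)))
  ; above-length = trans (length-++ (above p)) (cong₂ _+_ (above-length cp)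
      (trans (length-concatMap us λ u∈ → cong suc (above-length (All.lookup cus u∈)))
          (cong (_* suc v) |us|)))
  ; below≼ = λ x∈ → [ ≼-mono (n≤1+n e) ∘ below≼ cp , merged-below ∘ ∈-concatMap⁻′ ds ]′
      (∈-++⁻ (below p) x∈)
  ; ≼above = λ x∈ → [ ≼-mono (n≤1+n e) ∘ ≼above cp , merged-above ∘ ∈-concatMap⁻′ us ]′
      (∈-++⁻ (above p) x∈) }
  where
  merged-below : ∀ {x} → (∃ λ d → d ∈ ds × x ∈ downset d) → K ⊢ x ≼[ suc e ] centre p
  merged-below (d , d∈ , here refl) = ≼-mono (s≤s z≤n) (All.lookup ds≼p d∈)
  merged-below (d , d∈ , there x∈) = ≼-mono (≤-reflexive (+-comm e 1))
    (≼-trans (below≼ (All.lookup cds d∈) x∈) (All.lookup ds≼p d∈))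
  merged-above : ∀ {x} → (∃ λ u → u ∈ us × x ∈ upset u) → K ⊢ centre p ≼[ suc e ] x
  merged-above (u , u∈ , here refl) = ≼-mono (s≤s z≤n) (All.lookup p≼us u∈)
  merged-above (u , u∈ , there x∈) = ≼-trans (All.lookup p≼us u∈) (≼above (All.lookup cus u∈) x∈)

-- One level of pivot growth.

module Levels (n k i : ℕ) where
  open Selection n k i

  private variable
    K : Knowledge {n}
    d : ℕ

  module _ {K : Knowledge {n}} {R : Fin n → Fin n → Bool} where

    private
      -- The condition on centres keeps a pivot from counting itself in its own degrees.
      Up Down : Pivot n → Pivot n → Set
      Up p q = centre q ≢ centre p × R (centre q) (centre p) ≡ true
      Down p q = centre q ≢ centre p × R (centre q) (centre p) ≡ false

      Up? : ∀ p → Decidable (Up p)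
      Up? p q = ¬? (centre q Fin.≟ centre p) ×-dec (R (centre q) (centre p) Bool.≟ true)

      Down? : ∀ p → Decidable (Down p)
      Down? p q = ¬? (centre q Fin.≟ centre p) ×-dec (R (centre q) (centre p) Bool.≟ false)

      comparable : ∀ ps → IsTournament K R (map centre ps) → Unique (map centre ps) →
        AllPairs (λ p q → Up p q ⊎ Up q p) ps × AllPairs (λ p q → Down p q ⊎ Down q p) ps
      comparable [] _ _ = [] , []
      comparable (p ∷ ps) t (p∉ ∷ u) with comparable ps (λ x∈ y∈ → t (there x∈) (there y∈)) u
      ... | ups , downs = All.tabulate (proj₁ ∘ orient) ∷ ups , All.tabulate
          (proj₂ ∘ orient) ∷ downs
        where
        orient : ∀ {q} → q ∈ ps → (Up p q ⊎ Up q p) × (Down p q ⊎ Down q p)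
        orient {q} q∈ with All.lookup p∉ (∈-map⁺ centre q∈) | t (here refl)
            (there (∈-map⁺ centre q∈)) (All.lookup p∉ (∈-map⁺ centre q∈))
        ... | p≢q | _ , anti with R (centre p) (centre q)
        ... | true  = inj₂ (p≢q , refl) , inj₁ (p≢q ∘ sym , anti)
        ... | false = inj₁ (p≢q ∘ sym , anti) , inj₂ (p≢q , refl)

      answer-true : ∀ {b x y} → b ≡ true → Answered K b x y → K ⊢ y ≼[ 1 ] x
      answer-true refl a = a

      answer-false : ∀ {b x y} → b ≢ true → Answered K b x y → K ⊢ x ≼[ 1 ] y
      answer-false {true} b≢ a = contradiction refl b≢
      answer-false {false} b≢ a = a

      take-All : ∀ {P : Pivot n → Set} h {ps} → (∀ {p} → p ∈ ps → P p) → All P (take h ps)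
      take-All h f = All.tabulate λ p∈ → f (Sub.Any-resp-⊆ (Sub.take-⊆ h _) p∈)

    record Split (h : ℕ) (ps : List (Pivot n)) : Set where
      field
        pivot : Pivot n
        ups downs rest : List (Pivot n)
        perm : pivot ∷ (ups ++ downs) ++ rest ↭ ps
        ups-length : length ups ≡ h
        downs-length : length downs ≡ h
        ups≽ : All (λ q → Dominates K q pivot) ups
        downs≼ : All (Dominates K pivot) downs

    split : ∀ h ps → 4 * h < length ps → IsTournament K R (map centre ps) → Unique (map centre ps) →
        Split h ps
    split h ps big t u with comparable ps t u
    ... | pu , pd with median Up? Down? h pu pd big
    ... | p , p∈ , h≤up , h≤down with ∈-∃++ p∈
    ... | as , bs , refl = record
      { pivot = p ; ups = take h U ; downs = take h D ; rest = drop h U ++ drop h D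
      ; perm = ↭-trans (prep p (↭-trans
          (prove 4 ((w ⊕ x) ⊕ (y ⊕ z)) ((w ⊕ y) ⊕ (x ⊕ z))
              (take h U ∷ take h D ∷ drop h U ∷ drop h D ∷ []))
          (↭-trans (↭-reflexive (cong₂ _++_ (take++drop≡id h U) (take++drop≡id h D)))
              (filter-∁-↭ (Up? p) V))))
          (↭-sym (shift p as bs))
      ; ups-length = trans (length-take h U) (m≤n⇒m⊓n≡m (≤-trans h≤up (≤-reflexive
          (trans (↭-length (filter-↭ (Up? p) (shift p as bs)))
              (cong length (filter-reject (Up? p) {xs = V} (λ q → proj₁ q refl)))))))
      ; downs-length = trans (length-take h D) (m≤n⇒m⊓n≡m (≤-trans h≤down (≤-trans (≤-reflexive
          (trans (↭-length (filter-↭ (Down? p) (shift p as bs)))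
              (cong length (filter-reject (Down? p) {xs = V} (λ q → proj₁ q refl)))))
          (length-filter-mono (Down? p) (∁? (Up? p)) V λ _ dn up → case trans (sym (proj₂ up))
              (proj₂ dn) of λ ()))))
      ; ups≽ = take-All h up≽
      ; downs≼ = take-All h down≼ }
      where
      open CommutativeMonoidSolver (++-commutativeMonoid {A = Pivot n})
      w = var zero
      x = var (suc zero)
      y = var (suc (suc zero))
      z = var (suc (suc (suc zero)))
      V = as ++ bs
      U = filter (Up? p) V
      -- Defined as a complement so that `U` and `D` exhaust `V`. It contains every pivot satisfying
      -- `Down p`, hence at least `h` of them.
      D = filter (∁? (Up? p)) V
      centre∈ : ∀ {q} → q ∈ V → centre q ∈ map centre (as ++ p ∷ bs)
      centre∈ q∈ = ∈-map⁺ centre (∈-resp-↭ (↭-sym (shift p as bs)) (there q∈))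
      distinct : ∀ {q} → q ∈ V → centre q ≢ centre p
      distinct q∈ eq = All.lookup (AllPairs.head (Unique-resp (map⁺ centre (shift p as bs)) u))
          (∈-map⁺ centre q∈) (sym eq)
      up≽ : ∀ {q} → q ∈ U → Dominates K q p
      up≽ q∈ with ∈-filter⁻ (Up? p) {xs = V} q∈
      ... | q∈V , q≢p , Rqp = answer-true Rqp (proj₁ (t (centre∈ q∈V) (∈-map⁺ centre p∈) q≢p))
      down≼ : ∀ {q} → q ∈ D → Dominates K p q
      down≼ q∈ with ∈-filter⁻ (∁? (Up? p)) {xs = V} q∈
      ... | q∈V , ¬up = answer-false (λ Rqp → ¬up (distinct q∈V , Rqp))
        (proj₁ (t (centre∈ q∈V) (∈-map⁺ centre p∈) (distinct q∈V)))

  -- Each round merges `2h + 1` pivots of a window of `4h + 1` into one and returns the other `2h`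
  -- to the pool, until no window fits. The two length bounds say that at most `4h` pivots are left
  -- over.
  level : ∀ fuel h {e v ps} → length ps ≤ fuel → All (Certified K e v) ps → Unique (regions ps) →
    (∀ K′ → K′ ⊑ᴷ K → ∀ ps′ → All (Certified K′ (suc e) (v + h * suc v)) ps′ →
        regions ps′ ≲ regions ps →
      length ps′ * suc (2 * h) ≤ length ps → length ps + 2 ≤ suc (2 * h) * (length ps′ + 2) →
          Solvable K′ d) →
    Solvable K (4 * h * length ps + d)
  level {K = K} fuel h {ps = ps} ps≤ certs unique cont with length ps ≤? 4 * h
  -- With no merged pivot, the second length bound is `L + 2 ≤ 4h + 2 = (2h + 1) * 2`.
  ... | yes few = relax (m≤n+m _ (4 * h * length ps))
      (cont K (λ _ → id) [] [] (regions ps , ↭-refl) z≤n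
        (≤-trans (+-monoˡ-≤ 2 few) (≤-reflexive
            (solve 1 (λ h → con 4 :* h :+ con 2 := (con 1 :+ con 2 :* h) :* con 2) refl h))))
  level zero h ps≤ certs unique cont | no many = contradiction (≤-trans ps≤ z≤n) many
  level {K = K} {d = d} (suc fuel) h {e} {v} {ps} ps≤ certs unique cont | no many =
    relax budget (tournament (map centre W) λ K₁ s₁ R t → play K₁ s₁
        (split {R = R} h W (≤-reflexive (sym |W|)) t W-unique))
    where
    W = take (suc (4 * h)) ps
    rest = drop (suc (4 * h)) ps
    |W| : length W ≡ suc (4 * h)
    |W| = trans (length-take (suc (4 * h)) ps) (m≤n⇒m⊓n≡m (≰⇒> many))
    W-unique : Unique (map centre W)
    W-unique = proj₁ (Unique-++⁻ (map centre W) (subst Unique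
      (trans (cong (map centre) (sym (take++drop≡id (suc (4 * h)) ps))) (List.map-++ centre W rest))
      (≲-Unique (centres≲regions ps) unique)))
    remaining-length : ℕ
    remaining-length = length ps ∸ suc (2 * h)
    length-ps : length ps ≡ suc (2 * h) + remaining-length
    length-ps = sym (m+[n∸m]≡n (≤-trans (s≤s (*-monoˡ-≤ h (m≤m+n 2 2))) (≰⇒> many)))
    budget : triangle (length (map centre W)) +
        (4 * h * remaining-length + d) ≤ 4 * h * length ps + d
    budget = begin
      triangle (length (map centre W)) + (4 * h * remaining-length + d)
        ≡⟨ cong (λ l → triangle l + (4 * h * remaining-length + d))
            (trans (List.length-map centre W) |W|) ⟩
      triangle (suc (4 * h)) + (4 * h * remaining-length + d)
        ≡⟨ +-assoc (triangle (suc (4 * h))) (4 * h * remaining-length) d ⟨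
      triangle (suc (4 * h)) + 4 * h * remaining-length + d
        ≤⟨ +-monoˡ-≤ d (triangle-window h remaining-length) ⟩
      4 * h * (suc (2 * h) + remaining-length) + d
        ≡⟨ cong (λ l → 4 * h * l + d) length-ps ⟨
      4 * h * length ps + d                                               ∎
      where open ≤-Reasoning
    play : ∀ K₁ → K₁ ⊑ᴷ K → ∀ {R} → Split {K₁} {R} h W → Solvable K₁ (4 * h * remaining-length + d)
    play K₁ s₁ S = subst (λ l → Solvable K₁ (4 * h * l + d)) length-ps₁
      (level fuel h ps₁≤fuel (All.map (weakenCertified s₁) certs-ps₁) unique₁
        λ K₂ s₂ ps′ certs₂ sub lo hi →
        let s : K₂ ⊑ᴷ K
            s = λ val → s₁ val ∘ s₂ val
        in cont K₂ s (merge pivot ups downs ∷ ps′)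
          (merge-certified (weakenCertified s (All.head certs-perm))
              (All.map (weakenCertified s) (All.++⁻ˡ ups certs-merged))
             (All.map (weakenCertified s) (All.++⁻ʳ ups certs-merged)) ups-length downs-length
             (All.map (weaken s₂) ups≽) (All.map (weaken s₂) downs≼) ∷ certs₂)
          (≲-trans (≲-++ (merge-region pivot ups downs) sub)
              ([] , ↭-trans (++-identityʳ _) all-regions))
          (≤-trans (+-monoʳ-≤ (suc (2 * h)) lo) (≤-reflexive (sym length-ps′)))
          (≤-trans (≤-reflexive (trans (cong (_+ 2) length-ps′) (+-assoc (suc (2 * h)) _ 2)))
             (≤-trans (+-monoʳ-≤ (suc (2 * h)) hi)
                 (≤-reflexive (sym (*-suc (suc (2 * h)) (length ps′ + 2)))))))
      where
      open Split S renaming (rest to others)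
      ps₁ = others ++ rest
      perm₁ : pivot ∷ (ups ++ downs) ++ ps₁ ↭ ps
      perm₁ = ↭-trans (prep pivot (↭-sym (++-assoc (ups ++ downs) others rest)))
        (↭-trans (++⁺ʳ rest perm) (↭-reflexive (take++drop≡id (suc (4 * h)) ps)))
      all-regions : regions (pivot ∷ ups ++ downs) ++ regions ps₁ ↭ regions ps
      all-regions = ↭-trans (↭-reflexive (sym
          (List.concatMap-++ region (pivot ∷ ups ++ downs) ps₁))) (concatMap-↭ region perm₁)
      unique₁ : Unique (regions ps₁)
      unique₁ = proj₁ (proj₂ (Unique-++⁻ (regions (pivot ∷ ups ++ downs))
          (Unique-resp (↭-sym all-regions) unique)))
      certs-perm : All (Certified K e v) (pivot ∷ (ups ++ downs) ++ ps₁)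
      certs-perm = All-resp-↭ (↭-sym perm₁) certs
      certs-merged : All (Certified K e v) (ups ++ downs)
      certs-merged = All.++⁻ˡ (ups ++ downs) (All.tail certs-perm)
      certs-ps₁ : All (Certified K e v) ps₁
      certs-ps₁ = All.++⁻ʳ (ups ++ downs) (All.tail certs-perm)
      length-ps′ : length ps ≡ suc (2 * h) + length ps₁
      length-ps′ = trans (sym (↭-length perm₁)) (cong suc (trans (length-++ (ups ++ downs))
        (cong (_+ length ps₁) (trans (length-++ ups)
            (cong₂ _+_ ups-length (trans downs-length (sym (+-identityʳ h))))))))
      length-ps₁ : length ps₁ ≡ remaining-length
      length-ps₁ = +-cancelˡ-≡ (suc (2 * h)) _ _ (trans (sym length-ps′) length-ps)
      ps₁≤fuel : length ps₁ ≤ fuel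
      ps₁≤fuel = s≤s⁻¹ (≤-trans (≤-trans (s≤s (m≤n+m (length ps₁) (2 * h)))
          (≤-reflexive (sym length-ps′))) ps≤)

  -- Discarding elements with finished pivots.

  module _ {e v : ℕ} (e<k : suc e ≤ k) (2≤k : 2 ≤ k) where

    -- The answers split `Y` at the centre with error `1 + 1`. Without further queries, the kept
    -- side is then cut at the pivot's known upper or lower set with error `e + 1`, and either
    -- outcome misses a whole half. Only disjointness from `bs` is claimed, since parts of the
    -- region may have left `Y` earlier.
    compareWith : ∀ {p Y} → State K Y → Certified K e v p → Unique (region p) →
      (∀ K′ → K′ ⊑ᴷ K → ∀ Y′ → State K′ Y′ → (∀ {y} → y ∈ Y′ → y ∈ Y) →
        ∀ bs → length bs ≡ suc v → bs ≲ region p → (∀ {y} → y ∈ Y′ → y ∉ bs) → Solvable K′ d) →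
      Solvable K (length Y + d)
    compareWith {K = K} {d = d} {p = p} {Y = Y} S₀ c₀ unique cont = askAll z Y λ K′ s g a →
        partition K′ s g a
      where
      z = centre p
      below∉above : ∀ {y} → y ∈ below p → y ∉ above p
      below∉above = proj₂ (proj₂ (Unique-++⁻ (below p) (AllPairs.tail unique)))
      downset≲ : downset p ≲ region p
      downset≲ = above p , ↭-refl
      upset≲ : upset p ≲ region p
      upset≲ = below p , prep z (++-comm (above p) (below p))
      _∈?_ : ∀ y ys → Dec (y ∈ ys)
      y ∈? ys = any? (y Fin.≟_) ys

      partition : ∀ K′ → K′ ⊑ᴷ K → (g : Fin n → Bool) → (∀ {y} → y ∈ Y → Answered K′ (g y) z y) →
          Solvable K′ d
      partition K′ s g a = [ lowSide , highSide ]′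
          (cut Low? (λ x∈ y∈ lx ¬ly → ≼-mono 2≤k (≼-trans (low≼ x∈ lx) (≼high y∈ ¬ly))) S)
        where
        S = weakenState s S₀
        c = weakenCertified s c₀
        -- The centre belongs to the high side, however a query of `z` against itself is answered.
        Low : Fin n → Set
        Low y = g y ≡ true × y ≢ z
        Low? : Decidable Low
        Low? y = (g y Bool.≟ true) ×-dec ¬? (y Fin.≟ z)
        low≼ : ∀ {y} → y ∈ Y → Low y → K′ ⊢ y ≼[ 1 ] z
        low≼ {y} y∈ (gy , _) = subst (λ b → Answered K′ b z y) gy (a y∈)
        ≼high : ∀ {y} → y ∈ Y → ¬ Low y → K′ ⊢ z ≼[ 1 ] y
        ≼high {y} y∈ ¬low with y Fin.≟ z | g y | a y∈
        ... | yes refl | _     | _ = ≼-refl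
        ... | no y≢z   | true  | _ = contradiction (refl , y≢z) ¬low
        ... | no y≢z   | false | q = q

        finish : ∀ {Y′} → State K′ Y′ → (∀ {y} → y ∈ Y′ → y ∈ Y) → (∀ {y} → y ∈ Y′ → y ≢ z) →
          (∀ {y} → y ∈ Y′ → y ∉ below p) ⊎ (∀ {y} → y ∈ Y′ → y ∉ above p) → Solvable K′ d
        finish S′ ⊆Y ≢z (inj₁ ∉below) = cont K′ s _ S′ ⊆Y (downset p)
            (cong suc (below-length c)) downset≲
          λ { y∈ (here y≡z) → ≢z y∈ y≡z ; y∈ (there y∈b) → ∉below y∈ y∈b }
        finish S′ ⊆Y ≢z (inj₂ ∉above) = cont K′ s _ S′ ⊆Y (upset p)
            (cong suc (above-length c)) upset≲
          λ { y∈ (here y≡z) → ≢z y∈ y≡z ; y∈ (there y∈a) → ∉above y∈ y∈a }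

        -- Low elements lie below `z` with error 1, and `z` lies below `above p` with error `e`. If
        -- the part inside `above p` survives, it misses `below p` because the two are disjoint.
        lowSide : State K′ (filter Low? Y) → Solvable K′ d
        lowSide S₁ = [ (λ S₂ → finish S₂ (proj₁ ∘ from₁ ∘ proj₁ ∘ from₂)
            (proj₂ ∘ proj₂ ∘ from₁ ∘ proj₁ ∘ from₂) (inj₂ (proj₂ ∘ from₂)))
                     , (λ S₂ → finish S₂ (proj₁ ∘ from₁ ∘ proj₁ ∘ from₃)
                         (proj₂ ∘ proj₂ ∘ from₁ ∘ proj₁ ∘ from₃)
                         (inj₁ λ y∈ y∈b → proj₂ (from₃ y∈) (below∉above y∈b))) ]′
          (cut Rest? (λ {x} {y} x∈ y∈ _ ¬∉ → ≼-mono e<k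
              (≼-trans (low≼ (proj₁ (from₁ x∈)) (proj₂ (from₁ x∈)))
             (≼above c (decidable-stable (y ∈? above p) ¬∉)))) S₁)
          where
          Rest? : Decidable (_∉ above p)
          Rest? y = ¬? (y ∈? above p)
          from₁ : ∀ {y} → y ∈ filter Low? Y → y ∈ Y × Low y
          from₁ = ∈-filter⁻ Low?
          from₂ : ∀ {y} → y ∈ filter Rest? (filter Low? Y) → y ∈ filter Low? Y × y ∉ above p
          from₂ = ∈-filter⁻ Rest?
          from₃ : ∀ {y} → y ∈ filter (∁? Rest?) (filter Low? Y) → y ∈ filter Low? Y × ¬ y ∉ above p
          from₃ = ∈-filter⁻ (∁? Rest?)

        -- The mirror image, except that `z` is still present: it is first cut off as the lowest
        -- element, and is the output if the rank falls on it.
        highSide : State K′ (filter (∁? Low?) Y) → Solvable K′ d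
        highSide S₁ = [ output-only z (λ y∈ → proj₂
            (∈-filter⁻ (Fin._≟ z) {xs = filter (∁? Low?) Y} y∈)) , aboveCentre ]′
          (cut (Fin._≟ z) (λ { x∈ y∈ refl _ → ≼-mono (≤-trans (n≤1+n 1) 2≤k)
              (≼high (proj₁ (from₁ y∈)) (proj₂ (from₁ y∈))) }) S₁)
          where
          from₁ : ∀ {y} → y ∈ filter (∁? Low?) Y → y ∈ Y × ¬ Low y
          from₁ = ∈-filter⁻ (∁? Low?)
          H = filter (∁? (Fin._≟ z)) (filter (∁? Low?) Y)
          fromH : ∀ {y} → y ∈ H → (y ∈ Y × ¬ Low y) × y ≢ z
          fromH y∈ with ∈-filter⁻ (∁? (Fin._≟ z)) {xs = filter (∁? Low?) Y} y∈
          ... | y∈₁ , y≢z = from₁ y∈₁ , y≢z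
          Below? : Decidable (_∈ below p)
          Below? y = y ∈? below p
          aboveCentre : State K′ H → Solvable K′ d
          aboveCentre S₂ = [ (λ S₃ → finish S₃ (proj₁ ∘ proj₁ ∘ fromH ∘ proj₁ ∘ from₂)
              (proj₂ ∘ fromH ∘ proj₁ ∘ from₂)
                               (inj₂ (below∉above ∘ proj₂ ∘ from₂)))
                           , (λ S₃ → finish S₃ (proj₁ ∘ proj₁ ∘ fromH ∘ proj₁ ∘ from₃)
                               (proj₂ ∘ fromH ∘ proj₁ ∘ from₃)
                               (inj₁ (proj₂ ∘ from₃))) ]′
            (cut Below? (λ x∈ y∈ x∈b _ → ≼-mono (≤-trans (≤-reflexive (+-comm e 1)) e<k)
               (≼-trans (below≼ c x∈b) (≼high (proj₁ (proj₁ (fromH y∈)))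
                   (proj₂ (proj₁ (fromH y∈)))))) S₂)
            where
            from₂ : ∀ {y} → y ∈ filter Below? H → y ∈ H × y ∈ below p
            from₂ = ∈-filter⁻ Below?
            from₃ : ∀ {y} → y ∈ filter (∁? Below?) H → y ∈ H × y ∉ below p
            from₃ = ∈-filter⁻ (∁? Below?)

    -- All discarded halves together stay within the duplicate-free `regions ps`, so the losses of
    -- different pivots add up although `Y` shrinks in between.
    sweep : ∀ {Y} ps → State K Y → All (Certified K e v) ps → Unique (regions ps) →
      (∀ K′ → K′ ⊑ᴷ K → ∀ Y′ → State K′ Y′ → (∀ {y} → y ∈ Y′ → y ∈ Y) →
        ∀ bs → length bs ≡ length ps * suc v → bs ≲ regions ps → (∀ {y} → y ∈ Y′ → y ∉ bs) →
            Solvable K′ d) →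
      Solvable K (length ps * length Y + d)
    sweep {K = K} [] S [] unique cont = cont K (λ _ → id) _ S id [] refl ([] , ↭-refl) λ _ ()
    sweep {d = d} {Y = Y} (p ∷ ps) S (c ∷ certs) unique cont with Unique-++⁻ (region p) unique
    ... | unique-p , unique-ps , _ = relax (≤-reflexive
        (sym (+-assoc (length Y) (length ps * length Y) d)))
      (compareWith S c unique-p λ K₁ s₁ Y₁ S₁ Y₁⊆Y bs₁ |bs₁| bs₁≲ Y₁∩bs₁ →
        relax (+-monoˡ-≤ d (*-monoʳ-≤ (length ps) (Unique-length-≤ (State⇒Unique S₁) Y₁⊆Y)))
          (sweep ps S₁ (All.map (weakenCertified s₁) certs) unique-ps
            λ K₂ s₂ Y₂ S₂ Y₂⊆Y₁ bs₂ |bs₂| bs₂≲ Y₂∩bs₂ →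
            cont K₂ (λ val → s₁ val ∘ s₂ val) Y₂ S₂ (Y₁⊆Y ∘ Y₂⊆Y₁) (bs₁ ++ bs₂)
              (trans (length-++ bs₁) (cong₂ _+_ |bs₁| |bs₂|)) (≲-++ bs₁≲ bs₂≲)
              λ y∈ → [ Y₁∩bs₁ (Y₂⊆Y₁ y∈) , Y₂∩bs₂ y∈ ]′ ∘ ∈-++⁻ bs₁))

  -- Phases and their iteration.

  module _ (m r : ℕ) (1≤m : 1 ≤ m) (4≤r : 4 ≤ r) (2≤k : 2 ≤ k) where

    -- The hypothesis `e + j < k` reserves one unit of error for each level left and one for the
    -- comparisons of the sweep. The levels stop early once at most `6 * r` pivots remain.
    buildAndSweep : ∀ j h {e v Y ps} → e + j < k → State K Y → All (Certified K e v) ps →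
        regions ps ≲ Y →
      (let open Accounting m r (length Y) 4≤r) → Invariant j h v (length ps) →
      (∀ K′ → K′ ⊑ᴷ K → ∀ Y′ → State K′ Y′ → 3 * m * length Y′ + 2 * length Y ≤ 3 * m * length Y →
          Solvable K′ d) →
      Solvable K (8 * h * length ps + (6 * r * length Y + d))
    buildAndSweep {d = d} j h {e} {v} {Y} {ps} e+j<k S certs ps≲Y I cont with length ps ≤? 6 * r
    ... | yes few = relax (≤-trans (+-monoˡ-≤ d (*-monoˡ-≤ (length Y) few))
        (m≤n+m _ (8 * h * length ps)))
      (sweep (≤-trans (s≤s (m≤m+n e j)) e+j<k) 2≤k ps S certs (≲-Unique ps≲Y (State⇒Unique S))
        λ K′ s Y′ S′ Y′⊆Y bs |bs| bs≲ Y′∩bs → cont K′ s Y′ S′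
          -- `Y′` and `bs` are disjoint parts of the old `Y`, so
          -- `length Y′ + length ps * suc v ≤ length Y`.
          (remaining {v} {length ps} (Invariant.mass I)
              (≤-trans (≤-reflexive (trans (cong (length Y′ +_) (sym |bs|)) (sym (length-++ Y′))))
            (Unique-length-≤ (Unique-++ (State⇒Unique S′)
                (≲-Unique (≲-trans bs≲ ps≲Y) (State⇒Unique S)) Y′∩bs)
              λ x∈ → [ Y′⊆Y , ≲-∈ (≲-trans bs≲ ps≲Y) ]′ (∈-++⁻ Y′ x∈)))))
      where open Accounting m r (length Y) 4≤r
    buildAndSweep zero h {Y = Y} _ _ _ _ I _ | no many = contradiction (exhausted I) many
      where open Accounting m r (length Y) 4≤r
    buildAndSweep {d = d} (suc j) h {e} {v} {Y} {ps} e+j<k S certs ps≲Y I cont | no many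
      with windowSize h (length ps) (Accounting.Invariant.h-positive I)
          (≤-trans (*-monoʳ-≤ 6 4≤r) (<⇒≤ (≰⇒> many)))
    ... | h′ , size@(_ , h′≤h , _ , _) = relax (levels-cost (length ps) rest-cost h′≤h)
      (level (length ps) h′ ≤-refl certs (≲-Unique ps≲Y
          (State⇒Unique S)) λ K₁ s₁ ps′ certs′ ps′≲ps lo hi →
        relax (next-levels-cost h′ rest-cost lo)
          (buildAndSweep j (h′ * h′) (≤-trans (≤-reflexive (cong suc (sym (+-suc e j)))) e+j<k)
              (weakenState s₁ S) certs′
            (≲-trans ps′≲ps ps≲Y) (next I (≰⇒> many) size lo hi)
            λ K₂ s₂ → cont K₂ (λ val → s₁ val ∘ s₂ val)))
      where
      open Accounting m r (length Y) 4≤r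
      rest-cost = 6 * r * length Y + d

    singleton : Fin n → Pivot n
    singleton x = record { centre = x ; below = [] ; above = [] }

    singletons-certified : ∀ xs → All (Certified K 0 0) (map singleton xs)
    singletons-certified [] = []
    singletons-certified (_ ∷ xs) = record
      { below-length = refl ; above-length = refl ; below≼ = λ () ; ≼above = λ () }
      ∷ singletons-certified xs

    -- `m` and `r` stay fixed over all phases: the bound `suc r ^ m` persists as `Y` shrinks. Every
    -- phase on a nonempty `Y` discards something, which justifies `fuel`.
    select : ∀ fuel j {Y} → j < k → m ≡ 2 ^ j → length Y ≤ fuel → length Y ≤ suc r ^ m → State K Y →
      Solvable K (24 * m * r * length Y)
    select fuel j {[]} _ _ _ _ S = State-nonempty S
    select {K = K} (suc fuel) j {Y@(_ ∷ _)} j<k m≡ Y≤fuel Y≤r S = relax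
      (subst (λ l → 8 * suc r * l + (6 * r * length Y + next-budget) ≤ 24 * m * r * length Y)
          (sym length-ps) (phase-budget 1≤m))
      (buildAndSweep j (suc r) {ps = map singleton Y} j<k S (singletons-certified Y)
          ([] , ↭-reflexive (trans (List.++-identityʳ _) (regions-singletons Y)))
        (subst (Invariant j (suc r) 0) (sym length-ps) (initial j m≡ Y≤r))
        λ K′ s Y′ S′ removed → let Y′<Y = smaller (s≤s z≤n) removed in
          relax (remaining-budget removed)
            (select fuel j j<k m≡ (s≤s⁻¹ (≤-trans Y′<Y Y≤fuel)) (≤-trans (<⇒≤ Y′<Y) Y≤r) S′))
      where
      open Accounting m r (length Y) 4≤r
      length-ps : length (map singleton Y) ≡ length Y
      length-ps = List.length-map singleton Y
      regions-singletons : ∀ xs → regions (map singleton xs) ≡ xs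
      regions-singletons [] = refl
      regions-singletons (x ∷ xs) = cong (x ∷_) (regions-singletons xs)

theorem11 : (n k : ℕ) → 2 ≤ k → 2 ^ (2 ^ k) ≤ n →
  (i : ℕ) → 1 ≤ i → i ≤ n →
  Σ (Tree n) λ T →
  WithinBound n k (depth T) ×
  ((val : Values n) → AlwaysOutputs val (IsKOrder val k i) T)
-- With `k = suc j` there are `j` levels, `m = 2 ^ j`, and `r` is the integer part of the `m`-th
-- root of `n`.
theorem11 n (suc j) 2≤k big i 1≤i i≤n with floor-root (2 ^ j) n (m^n>0 2 j)
... | r , r^m≤n , n<r^m = T , within-bound , λ val → correct val _
  where
  open Selection n (suc j) i
  open Levels n (suc j) i
  m = 2 ^ j
  |allFin| : length (allFin n) ≡ n
  |allFin| = List.length-tabulate id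
  -- Otherwise `n < suc r ^ m ≤ 4 ^ m = 2 ^ (2 ^ k) ≤ n`; this is where the upper bound on `k`
  -- enters.
  4≤r : 4 ≤ r
  4≤r = ≮⇒≥ λ r<4 → <⇒≱ n<r^m (begin
    suc r ^ m         ≤⟨ ^-monoˡ-≤ m r<4 ⟩
    (2 ^ 2) ^ m       ≡⟨ ^-*-assoc 2 2 m ⟩
    2 ^ (2 ^ suc j)   ≤⟨ big ⟩
    n                 ∎)
    where open ≤-Reasoning
  start : State (λ _ → ⊤) (allFin n)
  start = record
    { lower = [] ; upper = [] ; perm = ++-identityʳ _
    ; lower≼Y = λ () ; lower≼upper = λ () ; Y≼upper = λ _ ()
    ; rank>lower = 1≤i ; rank≤Y = ≤-trans i≤n (≤-reflexive (sym |allFin|)) }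
  solution : Solvable (λ _ → ⊤) (24 * m * r * n)
  solution = subst (λ l → Solvable (λ _ → ⊤) (24 * m * r * l)) |allFin|
    (select m r (m^n>0 2 j) 4≤r 2≤k n j (n<1+n j) refl (≤-reflexive |allFin|)
      (≤-trans (≤-reflexive |allFin|) (<⇒≤ n<r^m)) start)
  T = proj₁ solution
  correct = proj₂ (proj₂ solution)
  -- `24 * m * n` is at most the first summand of `boundFactor`, and the remaining factor `r`
  -- becomes `r ^ m ≤ n`.
  within-bound : WithinBound n (suc j) (depth T)
  within-bound = begin
    depth T ^ m                           ≤⟨ ^-monoˡ-≤ m (proj₁ (proj₂ solution)) ⟩
    (24 * m * r * n) ^ m
      ≡⟨ cong (_^ m) (solve 3 (λ m r n → con 24 :* m :* r :* n := con 24 :* m :* n :* r)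
          refl m r n) ⟩
    (24 * m * n * r) ^ m
      ≤⟨ ^-monoˡ-≤ m (*-monoˡ-≤ r (≤-trans (*-monoˡ-≤ n (*-monoˡ-≤ m (n≤1+n 24))) (m≤m+n _ _))) ⟩
    (boundFactor n (suc j) * r) ^ m       ≡⟨ ^-distribʳ-* m (boundFactor n (suc j)) r ⟩
    boundFactor n (suc j) ^ m * r ^ m     ≤⟨ *-monoʳ-≤ (boundFactor n (suc j) ^ m) r^m≤n ⟩
    boundFactor n (suc j) ^ m * n         ∎
    where open ≤-Reasoning
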